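{- Let $G$ be a finite simple undirected graph and let $S$ be a spectrum (finite set of colors) of size $|S|\ge 2$ endowed with a symmetric matrix $W$ of non-negative real interferences, of size $|S|\times|S|$, for which $\gcd(W)$ exists. Let $t\in\mathbb{R}_{\ge 0}$ be a threshold such that $|S|\,t\ge \Delta(G)\,\|W\|_\infty$, where $\Delta(G)$ is the maximum vertex degree of $G$. (1) If $t$ is an integer multiple of $\gcd(W)$, then the $t$-interference chromatic number satisfies $$\chi_t(G,W)\le\left\lceil\frac{\Delta(G)\,\|W\|_\infty+\gcd(W)}{t+\gcd(W)}\right\rceil .$$ (2) If $t$ is not an integer multiple of $\gcd(W)$, then $$\chi_t(G,W)\le\left\lceil\frac{\Delta(G)\,\|W\|_\infty+\gcd(W)}{\gcd(W)\left\lfloor\frac{t}{\gcd(W)}\right\rfloor+\gcd(W)}\right\rceil .$$ Furthermore, these bounds are tight, i.e., each of the bounds in (1) and (2) is attained with equality by some finite simple undirected graph $G$, some spectrum $S$ of size $|S|\ge 2$ endowed with a symmetric $|S|\times|S|$ matrix $W$ of non-negative real interferences for which $\gcd(W)$ exists, and some threshold $t\in\mathbb{R}_{\ge 0}$ with $|S|\,t\ge \Delta(G)\,\|W\|_\infty$, where $t$ is an integer multiple of $\gcd(W)$ in the case of (1) and is not an integer multiple of $\gcd(W)$ in the case of (2).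
   Context: A spectrum is a finite set of colors $S=\{c_1,\ldots,c_s\}$, $s=|S|$, endowed with a symmetric $s\times s$ matrix $W$ of non-negative reals; $W(c_i,c_j)=W_{ij}$ is the interference between colors $c_i$ and $c_j$. A coloring of $G=(V,E)$ is any map $c:V\to S$ (monochromatic edges are allowed). A $k$-coloring is a coloring using at most $k$ different colors of $S$. The interference induced by $c$ at a vertex $v$ is $I_v(G,W,c)=\sum_{u\in N(v)}W(c(u),c(v))$, where $N(v)$ is the set of neighbors of $v$. For $t\in\mathbb{R}_{\ge 0}$, the $t$-interference chromatic number $\chi_t(G,W)$ is the minimum $k\in\mathbb{N}$, $k\geq 1$, such that $(G,W)$ admits a $k$-coloring $c$ with $I_v(G,W,c)\le t$ for every vertex $v$ (part of the assertion is that such a $k$ exists). The norm is $\|W\|_\infty=\max_i\sum_j W_{ij}$. The greatest common divisor is generalized to real numbers: $x>0$ divides $y$ if $y/x$ is an integer, and $\gcd(W)$ is the largest positive real number dividing all entries of $W$ (it exists when $W\ne 0$ and the entries of $W$ are integer multiples of a common positive real). -}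

module Defs where

open import Data.Fin as Fin using (Fin)
open import Data.Integer as ℤ using (ℤ; +_)
open import Data.List using (List; allFin; deduplicate; filter; foldr; length; map)
open import Data.List.Extrema.Nat using (max)
open import Data.Nat as ℕ using (ℕ)
import Data.Nat.Properties as ℕ
open import Data.Product using (Σ-syntax; ∃-syntax; _×_; _,_)
open import Data.Rational as ℚ using (ℚ; 0ℚ; 1ℚ; ½; ∣_∣)
import Data.Rational.Properties as ℚ
open import Data.Rational.Solver using (module +-*-Solver)
open import Data.Sum using (inj₁; inj₂)
open import Level using (0ℓ)
open import Relation.Binary.Core using (Rel)
open import Relation.Binary.Definitions using (Decidable; Irreflexive; Symmetric)
open import Relation.Binary.PropositionalEquality
  using (_≡_; refl; sym; trans; cong; cong₂; subst)
open import Relation.Nullary using (yes; no; contradiction)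

Cauchy : (ℕ → ℚ) → Set
Cauchy x = ∀ ε → 0ℚ ℚ.< ε →
  ∃[ N ] ∀ m n → N ℕ.≤ m → N ℕ.≤ n → ∣ x m ℚ.- x n ∣ ℚ.≤ ε

record ℝ : Set where
  constructor mkℝ
  field
    seq    : ℕ → ℚ
    cauchy : Cauchy seq

open ℝ public

infix 4 _≈_ _≤_ _<_

-- ℝ is a setoid of sequences: _≈_, not _≡_, is equality of real numbers.
_≈_ : ℝ → ℝ → Set
x ≈ y = ∀ ε → 0ℚ ℚ.< ε →
  ∃[ N ] ∀ n → N ℕ.≤ n → ∣ seq x n ℚ.- seq y n ∣ ℚ.≤ ε

_≤_ : ℝ → ℝ → Set
x ≤ y = ∀ ε → 0ℚ ℚ.< ε →
  ∃[ N ] ∀ n → N ℕ.≤ n → seq x n ℚ.≤ seq y n ℚ.+ ε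

_<_ : ℝ → ℝ → Set
x < y = ∃[ ε ] 0ℚ ℚ.< ε ×
  ∃[ N ] (∀ n → N ℕ.≤ n → seq x n ℚ.+ ε ℚ.≤ seq y n)

open +-*-Solver using (solve; _:=_; _:+_; _:*_; _:-_; :-_)

∣∣-bound : ∀ {p e} → p ℚ.≤ e → ℚ.- p ℚ.≤ e → ∣ p ∣ ℚ.≤ e
∣∣-bound {p} p≤e -p≤e with ℚ.∣p∣≡p∨∣p∣≡-p p
... | inj₁ eq = subst (ℚ._≤ _) (sym eq) p≤e
... | inj₂ eq = subst (ℚ._≤ _) (sym eq) -p≤e

p≤∣p∣ : ∀ p → p ℚ.≤ ∣ p ∣
p≤∣p∣ p with ℚ.≤-total 0ℚ p
... | inj₁ 0≤p = ℚ.≤-reflexive (sym (ℚ.0≤p⇒∣p∣≡p 0≤p))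
... | inj₂ p≤0 = ℚ.≤-trans p≤0 (ℚ.0≤∣p∣ p)

∣p-q∣≡∣q-p∣ : ∀ p q → ∣ p ℚ.- q ∣ ≡ ∣ q ℚ.- p ∣
∣p-q∣≡∣q-p∣ p q = trans (sym (ℚ.∣-p∣≡∣p∣ (p ℚ.- q)))
  (cong ∣_∣ (solve 2 (λ p q → :- (p :- q) := q :- p) refl p q))

∣p∣≤∣q∣+∣p-q∣ : ∀ p q → ∣ p ∣ ℚ.≤ ∣ q ∣ ℚ.+ ∣ p ℚ.- q ∣
∣p∣≤∣q∣+∣p-q∣ p q = ℚ.≤-trans
  (ℚ.≤-reflexive (cong ∣_∣ (solve 2 (λ p q → p := q :+ (p :- q)) refl p q)))
  (ℚ.∣p+q∣≤∣p∣+∣q∣ q (p ℚ.- q))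

p≤q+∣p-q∣ : ∀ {p q e} → ∣ p ℚ.- q ∣ ℚ.≤ e → p ℚ.≤ q ℚ.+ e
p≤q+∣p-q∣ {p} {q} {e} h = ℚ.≤-trans
  (ℚ.≤-reflexive (solve 2 (λ p q → p := q :+ (p :- q)) refl p q))
  (ℚ.+-monoʳ-≤ q (ℚ.≤-trans (p≤∣p∣ (p ℚ.- q)) h))

p≤q+e⇒p-q≤e : ∀ {p q e} → p ℚ.≤ q ℚ.+ e → p ℚ.- q ℚ.≤ e
p≤q+e⇒p-q≤e {p} {q} {e} h = ℚ.≤-trans (ℚ.+-monoˡ-≤ (ℚ.- q) h)
  (ℚ.≤-reflexive (solve 2 (λ q e → (q :+ e) :- q := e) refl q e))

½ε>0 : ∀ {ε} → 0ℚ ℚ.< ε → 0ℚ ℚ.< ½ ℚ.* ε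
½ε>0 = ℚ.*-monoʳ-<-pos ½

½ε+½ε≡ε : ∀ ε → ½ ℚ.* ε ℚ.+ ½ ℚ.* ε ≡ ε
½ε+½ε≡ε ε = trans (sym (ℚ.*-distribʳ-+ ε ½ ½)) (ℚ.*-identityˡ ε)

*-pos : ∀ {p q} → 0ℚ ℚ.< p → 0ℚ ℚ.< q → 0ℚ ℚ.< p ℚ.* q
*-pos {p} {q} p>0 q>0 = subst (ℚ._< p ℚ.* q) (ℚ.*-zeroʳ p)
  (ℚ.*-monoʳ-<-pos p ⦃ ℚ.positive p>0 ⦄ q>0)

+-diff : ∀ a b c d {e f} → ∣ a ℚ.- c ∣ ℚ.≤ e → ∣ b ℚ.- d ∣ ℚ.≤ f →
         ∣ (a ℚ.+ b) ℚ.- (c ℚ.+ d) ∣ ℚ.≤ e ℚ.+ f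
+-diff a b c d h k = ℚ.≤-trans
  (ℚ.≤-reflexive (cong ∣_∣
    (solve 4 (λ a b c d → (a :+ b) :- (c :+ d) := (a :- c) :+ (b :- d)) refl a b c d)))
  (ℚ.≤-trans (ℚ.∣p+q∣≤∣p∣+∣q∣ (a ℚ.- c) (b ℚ.- d)) (ℚ.+-mono-≤ h k))

⊔-diff : ∀ a b c d {e} → ∣ a ℚ.- c ∣ ℚ.≤ e → ∣ b ℚ.- d ∣ ℚ.≤ e →
         ∣ (a ℚ.⊔ b) ℚ.- (c ℚ.⊔ d) ∣ ℚ.≤ e
⊔-diff a b c d {e} h k = ∣∣-bound
  (p≤q+e⇒p-q≤e (half a b c d h k))
  (ℚ.≤-trans
    (ℚ.≤-reflexive (solve 2 (λ p q → :- (p :- q) := q :- p) refl (a ℚ.⊔ b) (c ℚ.⊔ d)))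
    (p≤q+e⇒p-q≤e (half c d a b
      (subst (ℚ._≤ e) (∣p-q∣≡∣q-p∣ a c) h)
      (subst (ℚ._≤ e) (∣p-q∣≡∣q-p∣ b d) k))))
  where
  half : ∀ a b c d → ∣ a ℚ.- c ∣ ℚ.≤ e → ∣ b ℚ.- d ∣ ℚ.≤ e →
         a ℚ.⊔ b ℚ.≤ (c ℚ.⊔ d) ℚ.+ e
  half a b c d h k = ℚ.⊔-lub
    (ℚ.≤-trans (p≤q+∣p-q∣ {a} {c} h) (ℚ.+-monoˡ-≤ e (ℚ.p≤p⊔q c d)))
    (ℚ.≤-trans (p≤q+∣p-q∣ {b} {d} k) (ℚ.+-monoˡ-≤ e (ℚ.p≤q⊔p c d)))

*-mono₂ : ∀ p q {r s} → ∣ p ∣ ℚ.≤ r → ∣ q ∣ ℚ.≤ s → ∣ p ℚ.* q ∣ ℚ.≤ r ℚ.* s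
*-mono₂ p q {r} {s} h k = ℚ.≤-trans (ℚ.≤-reflexive (ℚ.∣p*q∣≡∣p∣*∣q∣ p q))
  (ℚ.≤-trans
    (ℚ.*-monoʳ-≤-nonNeg ∣ q ∣ ⦃ ℚ.∣-∣-nonNeg q ⦄ h)
    (ℚ.*-monoˡ-≤-nonNeg r ⦃ ℚ.nonNegative (ℚ.≤-trans (ℚ.0≤∣p∣ p) h) ⦄ k))

*-diff : ∀ a b c d {e K L} → ∣ a ∣ ℚ.≤ K → ∣ d ∣ ℚ.≤ L →
         ∣ a ℚ.- c ∣ ℚ.≤ e → ∣ b ℚ.- d ∣ ℚ.≤ e →
         ∣ a ℚ.* b ℚ.- c ℚ.* d ∣ ℚ.≤ (K ℚ.+ L) ℚ.* e
*-diff a b c d {e} {K} {L} a≤K d≤L h k = ℚ.≤-trans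
  (ℚ.≤-reflexive (cong ∣_∣
    (solve 4 (λ a b c d → a :* b :- c :* d := a :* (b :- d) :+ d :* (a :- c))
      refl a b c d)))
  (ℚ.≤-trans (ℚ.∣p+q∣≤∣p∣+∣q∣ (a ℚ.* (b ℚ.- d)) (d ℚ.* (a ℚ.- c)))
  (ℚ.≤-trans (ℚ.+-mono-≤ (*-mono₂ a (b ℚ.- d) a≤K k) (*-mono₂ d (a ℚ.- c) d≤L h))
    (ℚ.≤-reflexive (sym (ℚ.*-distribʳ-+ e K L)))))

bounded : ∀ {x} → Cauchy x →
          ∃[ K ] 0ℚ ℚ.< K × ∃[ N ] (∀ n → N ℕ.≤ n → ∣ x n ∣ ℚ.≤ K)
bounded {x} cx with cx 1ℚ (ℚ.positive⁻¹ 1ℚ)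
... | N , h = ∣ x N ∣ ℚ.+ 1ℚ
  , ℚ.+-mono-≤-< (ℚ.0≤∣p∣ (x N)) (ℚ.positive⁻¹ 1ℚ)
  , N
  , λ n N≤n → ℚ.≤-trans (∣p∣≤∣q∣+∣p-q∣ (x n) (x N))
      (ℚ.+-monoʳ-≤ ∣ x N ∣ (h n N N≤n ℕ.≤-refl))

inv : ℚ → ℚ
inv q with q ℚ.≟ 0ℚ
... | yes _   = 0ℚ
... | no  q≢0 = ℚ.1/_ q ⦃ ℚ.≢-nonZero q≢0 ⦄

q*inv : ∀ {q} → 0ℚ ℚ.< q → q ℚ.* inv q ≡ 1ℚ
q*inv {q} q>0 with q ℚ.≟ 0ℚ
... | yes q≡0 = contradiction (sym q≡0) (ℚ.<⇒≢ q>0)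
... | no  q≢0 = ℚ.*-inverseʳ q ⦃ ℚ.≢-nonZero q≢0 ⦄

inv>0 : ∀ {q} → 0ℚ ℚ.< q → 0ℚ ℚ.< inv q
inv>0 {q} q>0 with q ℚ.≟ 0ℚ
... | yes q≡0 = contradiction (sym q≡0) (ℚ.<⇒≢ q>0)
... | no  q≢0 = ℚ.positive⁻¹ _ ⦃ ℚ.1/pos⇒pos q ⦃ ℚ.positive q>0 ⦄ ⦄

inv-antimono : ∀ {p q} → 0ℚ ℚ.< p → p ℚ.≤ q → ∣ inv q ∣ ℚ.≤ inv p
inv-antimono {p} {q} p>0 p≤q = ℚ.≤-trans
  (ℚ.≤-reflexive (trans (ℚ.0≤p⇒∣p∣≡p (ℚ.<⇒≤ (inv>0 q>0)))
    (trans (sym (ℚ.*-identityʳ (inv q))) (cong (inv q ℚ.*_) (sym (q*inv p>0))))))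
  (ℚ.≤-trans
    (ℚ.*-monoˡ-≤-nonNeg (inv q) ⦃ ℚ.nonNegative (ℚ.<⇒≤ (inv>0 q>0)) ⦄
      (ℚ.*-monoʳ-≤-nonNeg (inv p) ⦃ ℚ.nonNegative (ℚ.<⇒≤ (inv>0 p>0)) ⦄ p≤q))
    (ℚ.≤-reflexive (trans
      (solve 3 (λ iq q ip → iq :* (q :* ip) := (q :* iq) :* ip) refl (inv q) q (inv p))
      (trans (cong (ℚ._* inv p) (q*inv q>0)) (ℚ.*-identityˡ (inv p))))))
  where q>0 = ℚ.<-≤-trans p>0 p≤q

inv-diff : ∀ {p q} → 0ℚ ℚ.< p → 0ℚ ℚ.< q →
           inv p ℚ.- inv q ≡ (q ℚ.- p) ℚ.* (inv p ℚ.* inv q)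
inv-diff {p} {q} p>0 q>0 = sym (trans
  (solve 4 (λ p q ip iq → (q :- p) :* (ip :* iq) := (q :* iq) :* ip :- (p :* ip) :* iq)
    refl p q (inv p) (inv q))
  (cong₂ ℚ._-_
    (trans (cong (ℚ._* inv p) (q*inv q>0)) (ℚ.*-identityˡ (inv p)))
    (trans (cong (ℚ._* inv q) (q*inv p>0)) (ℚ.*-identityˡ (inv q)))))

fromℚ : ℚ → ℝ
fromℚ q = mkℝ (λ _ → q) λ ε ε>0 → 0 , λ _ _ _ _ →
  ℚ.≤-trans (ℚ.≤-reflexive (cong ∣_∣ (ℚ.+-inverseʳ q))) (ℚ.<⇒≤ ε>0)

fromℤ : ℤ → ℝ
fromℤ z = fromℚ (z ℚ./ 1)

fromℕ : ℕ → ℝ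
fromℕ n = fromℤ (+ n)

0ℝ : ℝ
0ℝ = fromℚ 0ℚ

infixl 6 _+_ _⊔_
infixl 7 _*_ _/_[_]

_+_ : ℝ → ℝ → ℝ
mkℝ x cx + mkℝ y cy = mkℝ (λ n → x n ℚ.+ y n) λ ε ε>0 →
  let M , f = cx (½ ℚ.* ε) (½ε>0 ε>0)
      N , g = cy (½ ℚ.* ε) (½ε>0 ε>0)
  in M ℕ.⊔ N , λ m n m≥ n≥ → ℚ.≤-trans
       (+-diff (x m) (y m) (x n) (y n)
         (f m n (ℕ.m⊔n≤o⇒m≤o M N m≥) (ℕ.m⊔n≤o⇒m≤o M N n≥))
         (g m n (ℕ.m⊔n≤o⇒n≤o M N m≥) (ℕ.m⊔n≤o⇒n≤o M N n≥)))
       (ℚ.≤-reflexive (½ε+½ε≡ε ε))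

_⊔_ : ℝ → ℝ → ℝ
mkℝ x cx ⊔ mkℝ y cy = mkℝ (λ n → x n ℚ.⊔ y n) λ ε ε>0 →
  let M , f = cx ε ε>0
      N , g = cy ε ε>0
  in M ℕ.⊔ N , λ m n m≥ n≥ →
       ⊔-diff (x m) (y m) (x n) (y n)
         (f m n (ℕ.m⊔n≤o⇒m≤o M N m≥) (ℕ.m⊔n≤o⇒m≤o M N n≥))
         (g m n (ℕ.m⊔n≤o⇒n≤o M N m≥) (ℕ.m⊔n≤o⇒n≤o M N n≥))

_*_ : ℝ → ℝ → ℝ
mkℝ x cx * mkℝ y cy = mkℝ (λ n → x n ℚ.* y n) λ ε ε>0 →
  let K , K>0 , A , a = bounded cx
      L , L>0 , B , b = bounded cy
      K+L>0 = ℚ.+-mono-< K>0 L>0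
      δ   = inv (K ℚ.+ L) ℚ.* ε
      δ>0 = *-pos (inv>0 K+L>0) ε>0
      M , f = cx δ δ>0
      N , g = cy δ δ>0
      P = A ℕ.⊔ B
      Q = M ℕ.⊔ N
  in P ℕ.⊔ Q , λ m n m≥ n≥ →
       let m≥P = ℕ.m⊔n≤o⇒m≤o P Q m≥
           n≥P = ℕ.m⊔n≤o⇒m≤o P Q n≥
           m≥Q = ℕ.m⊔n≤o⇒n≤o P Q m≥
           n≥Q = ℕ.m⊔n≤o⇒n≤o P Q n≥
       in ℚ.≤-trans
            (*-diff (x m) (y m) (x n) (y n)
              (a m (ℕ.m⊔n≤o⇒m≤o A B m≥P)) (b n (ℕ.m⊔n≤o⇒n≤o A B n≥P))
              (f m n (ℕ.m⊔n≤o⇒m≤o M N m≥Q) (ℕ.m⊔n≤o⇒m≤o M N n≥Q))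
              (g m n (ℕ.m⊔n≤o⇒n≤o M N m≥Q) (ℕ.m⊔n≤o⇒n≤o M N n≥Q)))
            (ℚ.≤-reflexive (trans (sym (ℚ.*-assoc (K ℚ.+ L) (inv (K ℚ.+ L)) ε))
              (trans (cong (ℚ._* ε) (q*inv K+L>0)) (ℚ.*-identityˡ ε))))

-- Only finitely many terms of the sequence can vanish, so the junk value
-- inv 0ℚ = 0ℚ does not affect the limit.
recip : (x : ℝ) → 0ℝ < x → ℝ
recip (mkℝ x cx) (e , e>0 , A , a) = mkℝ (λ n → inv (x n)) λ ε ε>0 →
  let δ   = ε ℚ.* (e ℚ.* e)
      N , f = cx δ (*-pos ε>0 (*-pos e>0 e>0))
  in A ℕ.⊔ N , λ m n m≥ n≥ →
       let e≤x : ∀ k → A ℕ.⊔ N ℕ.≤ k → e ℚ.≤ x k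
           e≤x k k≥ = ℚ.≤-trans (ℚ.≤-reflexive (sym (ℚ.+-identityˡ e)))
                        (a k (ℕ.m⊔n≤o⇒m≤o A N k≥))
           e≤xm = e≤x m m≥
           e≤xn = e≤x n n≥
       in ℚ.≤-trans
            (ℚ.≤-reflexive (cong ∣_∣
              (inv-diff (ℚ.<-≤-trans e>0 e≤xm) (ℚ.<-≤-trans e>0 e≤xn))))
            (ℚ.≤-trans
              (*-mono₂ (x n ℚ.- x m) (inv (x m) ℚ.* inv (x n))
                (f n m (ℕ.m⊔n≤o⇒n≤o A N n≥) (ℕ.m⊔n≤o⇒n≤o A N m≥))
                (*-mono₂ (inv (x m)) (inv (x n))
                  (inv-antimono e>0 e≤xm) (inv-antimono e>0 e≤xn)))
              (ℚ.≤-reflexive (trans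
                (solve 3 (λ ε e i → ε :* (e :* e) :* (i :* i) := ε :* ((e :* i) :* (e :* i)))
                  refl ε e (inv e))
                (trans (cong (λ u → ε ℚ.* (u ℚ.* u)) (q*inv e>0)) (ℚ.*-identityʳ ε)))))

_/_[_] : ℝ → (y : ℝ) → 0ℝ < y → ℝ
x / y [ y>0 ] = x * recip y y>0

sum : List ℝ → ℝ
sum = foldr _+_ 0ℝ

infix 4 _∣ℝ_

_∣ℝ_ : ℝ → ℝ → Set
x ∣ℝ y = Σ[ x>0 ∈ 0ℝ < x ] ∃[ z ] y / x [ x>0 ] ≈ fromℤ z

-- Rounding is not a computable function of a real, hence the relations.
IsFloor : ℝ → ℤ → Set
IsFloor x z = fromℤ z ≤ x × x < fromℤ (ℤ.suc z)

IsCeiling : ℝ → ℤ → Set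
IsCeiling x z = fromℤ (ℤ.pred z) < x × x ≤ fromℤ z

-- Positivity of the divisor is part of both relations.
IsFloorOfQuotient : ℝ → ℝ → ℤ → Set
IsFloorOfQuotient x y z = Σ[ y>0 ∈ 0ℝ < y ] IsFloor (x / y [ y>0 ]) z

IsCeilingOfQuotient : ℝ → ℝ → ℤ → Set
IsCeilingOfQuotient x y z = Σ[ y>0 ∈ 0ℝ < y ] IsCeiling (x / y [ y>0 ]) z

record Graph (n : ℕ) : Set₁ where
  infix 4 _~_ _~?_
  field
    _~_      : Rel (Fin n) 0ℓ
    _~?_     : Decidable _~_
    ~-sym    : Symmetric _~_
    ~-irrefl : Irreflexive _≡_ _~_

  neighbours : Fin n → List (Fin n)
  neighbours v = filter (v ~?_) (allFin n)

  degree : Fin n → ℕ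
  degree v = length (neighbours v)

  Δ : ℕ
  Δ = max 0 (map degree (allFin n))

record Spectrum (s : ℕ) : Set where
  field
    W        : Fin s → Fin s → ℝ
    W-sym    : ∀ i j → W i j ≈ W j i
    W-nonNeg : ∀ i j → 0ℝ ≤ W i j

  rowSum : Fin s → ℝ
  rowSum i = sum (map (W i) (allFin s))

  -- Row sums are non-negative, so the base value 0ℝ does not alter the
  -- maximum.
  ‖W‖∞ : ℝ
  ‖W‖∞ = foldr _⊔_ 0ℝ (map rowSum (allFin s))

  DividesAll : ℝ → Set
  DividesAll x = ∀ i j → x ∣ℝ W i j

  IsGCD : ℝ → Set
  IsGCD g = 0ℝ < g × DividesAll g × (∀ x → 0ℝ < x → DividesAll x → x ≤ g)

module _ {n s : ℕ} (G : Graph n) (S : Spectrum s) where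
  open Graph G
  open Spectrum S

  Colouring : Set
  Colouring = Fin n → Fin s

  coloursUsed : Colouring → ℕ
  coloursUsed c = length (deduplicate Fin._≟_ (map c (allFin n)))

  interference : Colouring → Fin n → ℝ
  interference c v = sum (map (λ u → W (c u) (c v)) (neighbours v))

  Admits : ℝ → ℕ → Set
  Admits t k = Σ[ c ∈ Colouring ] coloursUsed c ℕ.≤ k × (∀ v → interference c v ≤ t)

  IsChromaticNumber : ℝ → ℕ → Set
  IsChromaticNumber t k =
    1 ℕ.≤ k × Admits t k × (∀ j → 1 ℕ.≤ j → Admits t j → k ℕ.≤ j)

  -- g stands for gcd(W).
  record Admissible (g t : ℝ) : Set where
    field
      s≥2     : 2 ℕ.≤ s
      isGCD   : IsGCD g
      t≥0     : 0ℝ ≤ t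
      Δ‖W‖≤st : fromℕ Δ * ‖W‖∞ ≤ fromℕ s * t

  IsBound₁ : ℝ → ℝ → ℤ → Set
  IsBound₁ g t b = IsCeilingOfQuotient (fromℕ Δ * ‖W‖∞ + g) (t + g) b

  -- f stands for ⌊ t / g ⌋.
  IsBound₂ : ℝ → ℤ → ℤ → Set
  IsBound₂ g f b = IsCeilingOfQuotient (fromℕ Δ * ‖W‖∞ + g) (g * fromℤ f + g) b

{-# OPTIONS --safe #-}
module Submission where

-- Every entry of W is a natural multiple of g = gcd(W), so interferences only
-- take values in g ℕ and t may be replaced by T = ⌊ t / g ⌋.  With
-- k = ⌊ Δ M / (T + 1) ⌋ + 1 = ⌈ (Δ M + 1) / (T + 1) ⌉ colours, where
-- M = ‖W‖∞ / g, the potential interferences at a vertex over the k colours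
-- have sum at most Δ M < k (T + 1), so some colour costs at most T there.
-- Moving a vertex whose interference exceeds T to such a colour strictly
-- decreases the total interference, hence this process stops.  The hypothesis
-- |S| t ≥ Δ ‖W‖∞ gives k ≤ |S|.
--
-- Both bounds are attained by K₂ with W = (3 1; 1 3), where gcd(W) = 1,
-- ‖W‖∞ = 4 and |S| = 2, for t = 2 and t = 5/2: one colour gives interference 3,
-- two colours give 1.

open import Defs
open import Data.Integer using (ℤ; +_) renaming (_≤_ to _≤ℤ_)
open import Data.Nat using (ℕ)
open import Data.Product using (Σ-syntax; ∃-syntax; _×_)
open import Relation.Nullary using (¬_)

import Algebra.Properties.Semiring.Sum
open import Data.Bool using (true; false; if_then_else_)
open import Data.Fin as Fin using (Fin; zero; suc; inject≤; punchIn; finToFun; funToFin)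
import Data.Fin.Properties as Fin
open import Data.Integer as ℤ using (-[1+_])
import Data.Integer.Properties as ℤ
open import Data.List
  using (List; []; _∷_; allFin; deduplicate; filter; foldr; length; lookup; map; tabulate)
import Data.List.Extrema.Nat as List
open import Data.List.Membership.Propositional using (_∈_)
open import Data.List.Membership.Propositional.Properties
  using (∈-map⁺; ∈-map⁻; ∈-allFin; ∈-lookup; ∈-deduplicate⁻)
import Data.List.Properties as List
open import Data.List.Relation.Unary.All as All using ()
open import Data.List.Relation.Unary.AllPairs using (_∷_)
open import Data.List.Relation.Unary.Any using (here; there)
open import Data.List.Relation.Unary.Unique.DecPropositional.Properties using (deduplicate-!)
open import Data.List.Relation.Unary.Unique.Propositional using (Unique)
open import Data.Nat as ℕ using (zero; suc; s≤s; z≤n)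
open import Data.Nat.Coprimality using (1-coprimeTo) renaming (sym to coprime-sym)
import Data.Nat.DivMod as ℕ
open import Data.Nat.Induction using (<-rec; <-wellFounded)
import Data.Nat.ListAction as ℕ
import Data.Nat.Properties as ℕ
open import Data.Nat.Tactic.RingSolver using (solve-∀)
open import Data.Product using (_,_; proj₁; proj₂; uncurry)
open import Data.Rational as ℚ using (ℚ; 0ℚ; ½; ∣_∣; mkℚ)
import Data.Rational.Properties as ℚ
open import Data.Rational.Solver using (module +-*-Solver)
open import Data.Sum using (inj₁; inj₂)
open import Data.Vec.Functional using (removeAt; updateAt)
open import Data.Vec.Functional.Properties using (updateAt-minimal; updateAt-updates)
open import Function using (_∘_; const; id)
open import Induction.WellFounded using (Acc; acc)
open import Level using (0ℓ)
open import Relation.Binary.Definitions using (_Respects₂_; tri<; tri≈; tri>)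
open import Relation.Binary.PropositionalEquality
  using (_≡_; _≢_; _≗_; refl; sym; trans; cong; cong₂; subst; subst₂; module ≡-Reasoning)
open import Relation.Binary.Structures using (IsPreorder)
open import Relation.Nullary using (Dec; contradiction; does; no; yes)
open import Relation.Nullary.Decidable using (_×-dec_; ¬?; dec-false; from-yes; map′)
open import Relation.Unary using (Decidable; Pred)

open +-*-Solver using (solve; _:=_; _:+_; _:*_; _:-_; :-_)

-- Arithmetic and order of real numbers

-- The implicit real arguments are passed explicitly throughout: the relations
-- unfold to statements about the sequences, which do not determine the reals.

Eventually : (ℕ → Set) → Set
Eventually P = ∃[ N ] ∀ n → N ℕ.≤ n → P n

zipE : ∀ {P Q R : ℕ → Set} → (∀ n → P n → Q n → R n) →
       Eventually P → Eventually Q → Eventually R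
zipE f (M , p) (N , q) = M ℕ.⊔ N , λ n h →
  f n (p n (ℕ.m⊔n≤o⇒m≤o M N h)) (q n (ℕ.m⊔n≤o⇒n≤o M N h))

mapE : ∀ {P Q : ℕ → Set} → (∀ n → P n → Q n) → Eventually P → Eventually Q
mapE f (N , p) = N , λ n h → f n (p n h)

-- Identities that involve `inv` hold only for late terms, where the divisor is nonzero; this is
-- enough for `_≈_`.
≡ᵉ⇒≈ : ∀ {x y} → Eventually (λ n → seq x n ≡ seq y n) → x ≈ y
≡ᵉ⇒≈ {x} {y} h ε ε>0 = mapE (λ n eq → ℚ.≤-trans
  (ℚ.≤-reflexive (trans (cong (λ u → ∣ u ℚ.- seq y n ∣) eq)
    (cong ∣_∣ (ℚ.+-inverseʳ (seq y n)))))
  (ℚ.<⇒≤ ε>0)) h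

≡⇒≈ : ∀ {x y} → (∀ n → seq x n ≡ seq y n) → x ≈ y
≡⇒≈ {x} {y} h = ≡ᵉ⇒≈ {x} {y} (0 , λ n _ → h n)

≈-refl : ∀ {x} → x ≈ x
≈-refl {x} = ≡⇒≈ {x} {x} λ _ → refl

≈-sym : ∀ {x y} → x ≈ y → y ≈ x
≈-sym {x} {y} h ε ε>0 =
  mapE (λ n → subst (ℚ._≤ ε) (∣p-q∣≡∣q-p∣ (seq x n) (seq y n))) (h ε ε>0)

≈⇒≤ : ∀ {x y} → x ≈ y → x ≤ y
≈⇒≤ {x} {y} h ε ε>0 = mapE (λ n → p≤q+∣p-q∣ {seq x n} {seq y n}) (h ε ε>0)

≤-antisym : ∀ {x y} → x ≤ y → y ≤ x → x ≈ y
≤-antisym {x} {y} h k ε ε>0 = zipE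
  (λ n p q → ∣∣-bound (p≤q+e⇒p-q≤e {seq x n} {seq y n} p)
    (ℚ.≤-trans
      (ℚ.≤-reflexive (solve 2 (λ p q → :- (p :- q) := q :- p) refl (seq x n) (seq y n)))
      (p≤q+e⇒p-q≤e {seq y n} {seq x n} q)))
  (h ε ε>0) (k ε ε>0)

+-½-½ : ∀ p ε → p ℚ.+ ½ ℚ.* ε ℚ.+ ½ ℚ.* ε ≡ p ℚ.+ ε
+-½-½ p ε = trans (ℚ.+-assoc p (½ ℚ.* ε) (½ ℚ.* ε)) (cong (p ℚ.+_) (½ε+½ε≡ε ε))

≤-trans : ∀ {x y z} → x ≤ y → y ≤ z → x ≤ z
≤-trans {x} {y} {z} h k ε ε>0 = zipE
  (λ n p q → ℚ.≤-trans p (ℚ.≤-trans (ℚ.+-monoˡ-≤ (½ ℚ.* ε) q)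
    (ℚ.≤-reflexive (+-½-½ (seq z n) ε))))
  (h (½ ℚ.* ε) (½ε>0 ε>0)) (k (½ ℚ.* ε) (½ε>0 ε>0))

≈-trans : ∀ {x y z} → x ≈ y → y ≈ z → x ≈ z
≈-trans {x} {y} {z} h k = ≤-antisym {x} {z}
  (≤-trans {x} {y} {z} (≈⇒≤ {x} {y} h) (≈⇒≤ {y} {z} k))
  (≤-trans {z} {y} {x} (≈⇒≤ {z} {y} (≈-sym {y} {z} k)) (≈⇒≤ {y} {x} (≈-sym {x} {y} h)))

<⇒≤ : ∀ {x y} → x < y → x ≤ y
<⇒≤ {x} {y} (δ , δ>0 , h) ε ε>0 = mapE
  (λ n p → ℚ.≤-trans (p≤p+q (seq x n) δ>0) (ℚ.≤-trans p (p≤p+q (seq y n) ε>0))) h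
  where
  p≤p+q : ∀ p {q} → 0ℚ ℚ.< q → p ℚ.≤ p ℚ.+ q
  p≤p+q p q>0 = ℚ.≤-trans (ℚ.≤-reflexive (sym (ℚ.+-identityʳ p)))
    (ℚ.+-monoʳ-≤ p (ℚ.<⇒≤ q>0))

-- Half of the gap in `x < y` absorbs the error allowed by `y ≤ z`; the other half remains as the
-- gap.
<-≤-trans : ∀ {x y z} → x < y → y ≤ z → x < z
<-≤-trans {x} {y} {z} (ε , ε>0 , h) k = ½ ℚ.* ε , ½ε>0 ε>0 , zipE
  (λ n p q → ℚ.≤-trans (ℚ.≤-reflexive (shift (seq x n)))
    (p≤q+e⇒p-e≤q (ℚ.≤-trans p q)))
  h (k (½ ℚ.* ε) (½ε>0 ε>0))
  where
  shift : ∀ p → p ℚ.+ ½ ℚ.* ε ≡ (p ℚ.+ ε) ℚ.- ½ ℚ.* ε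
  shift p = trans (solve 2 (λ p e → p :+ e := (p :+ e :+ e) :- e) refl p (½ ℚ.* ε))
    (cong (ℚ._- (½ ℚ.* ε)) (+-½-½ p ε))
  p≤q+e⇒p-e≤q : ∀ {p q e} → p ℚ.≤ q ℚ.+ e → p ℚ.- e ℚ.≤ q
  p≤q+e⇒p-e≤q {p} {q} {e} h = p≤q+e⇒p-q≤e (ℚ.≤-trans h (ℚ.≤-reflexive (ℚ.+-comm q e)))

≤-<-trans : ∀ {x y z} → x ≤ y → y < z → x < z
≤-<-trans {x} {y} {z} h (ε , ε>0 , k) = ½ ℚ.* ε , ½ε>0 ε>0 , zipE
  (λ n p q → ℚ.≤-trans (ℚ.+-monoˡ-≤ (½ ℚ.* ε) p)
    (ℚ.≤-trans (ℚ.≤-reflexive (+-½-½ (seq y n) ε)) q))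
  (h (½ ℚ.* ε) (½ε>0 ε>0)) k

<-irrefl : ∀ {x} → ¬ x < x
<-irrefl {x} (ε , ε>0 , N , h) = ℚ.<-irrefl refl (ℚ.<-≤-trans
  (ℚ.≤-<-trans (ℚ.≤-reflexive (sym (ℚ.+-identityʳ (seq x N)))) (ℚ.+-monoʳ-< (seq x N) ε>0))
  (h N ℕ.≤-refl))

≤-isPreorder : IsPreorder _≈_ _≤_
≤-isPreorder = record
  { isEquivalence = record
    { refl  = λ {x} → ≈-refl {x}
    ; sym   = λ {x} {y} → ≈-sym {x} {y}
    ; trans = λ {x} {y} {z} → ≈-trans {x} {y} {z} }
  ; reflexive = λ {x} {y} → ≈⇒≤ {x} {y}
  ; trans     = λ {x} {y} {z} → ≤-trans {x} {y} {z} }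

<-resp-≈ : _<_ Respects₂ _≈_
<-resp-≈ = (λ {x} {y} {z} y≈z x<y → <-≤-trans {x} {y} {z} x<y (≈⇒≤ {y} {z} y≈z))
         , (λ {x} {y} {z} y≈z y<x →
             ≤-<-trans {z} {y} {x} (≈⇒≤ {z} {y} (≈-sym {y} {z} y≈z)) y<x)

module ℝ-Reasoning where
  open import Relation.Binary.Reasoning.Base.Triple
    {_≈_ = _≈_} {_≤_ = _≤_} {_<_ = _<_}
    ≤-isPreorder
    (λ {x} {y} x<y y<x →
      <-irrefl {x} (<-≤-trans {x} {y} {x} x<y (<⇒≤ {y} {x} y<x)))
    (λ {x} {y} {z} x<y y<z → <-≤-trans {x} {y} {z} x<y (<⇒≤ {y} {z} y<z))
    <-resp-≈
    (λ {x} {y} → <⇒≤ {x} {y})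
    (λ {x} {y} {z} → <-≤-trans {x} {y} {z})
    (λ {x} {y} {z} → ≤-<-trans {x} {y} {z})
    public

+-cong : ∀ {x y u v} → x ≈ y → u ≈ v → x + u ≈ y + v
+-cong {x} {y} {u} {v} h k ε ε>0 = zipE
  (λ n p q → ℚ.≤-trans (+-diff (seq x n) (seq u n) (seq y n) (seq v n) p q)
    (ℚ.≤-reflexive (½ε+½ε≡ε ε)))
  (h (½ ℚ.* ε) (½ε>0 ε>0)) (k (½ ℚ.* ε) (½ε>0 ε>0))

⊔-cong : ∀ {x y u v} → x ≈ y → u ≈ v → x ⊔ u ≈ y ⊔ v
⊔-cong {x} {y} {u} {v} h k ε ε>0 = zipE
  (λ n → ⊔-diff (seq x n) (seq u n) (seq y n) (seq v n)) (h ε ε>0) (k ε ε>0)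

K*[inv[K]*ε]≡ε : ∀ {K} ε → 0ℚ ℚ.< K → K ℚ.* (inv K ℚ.* ε) ≡ ε
K*[inv[K]*ε]≡ε {K} ε K>0 = trans (sym (ℚ.*-assoc K (inv K) ε))
  (trans (cong (ℚ._* ε) (q*inv K>0)) (ℚ.*-identityˡ ε))

-- Late terms of `x` are bounded by some `K`, so an error of `ε / K` in the other factor suffices.
*-congˡ : ∀ x {y z} → y ≈ z → x * y ≈ x * z
*-congˡ x {y} {z} h ε ε>0 =
  let K , K>0 , b = bounded (cauchy x)
  in zipE
    (λ n p q → ℚ.≤-trans
      (ℚ.≤-reflexive (cong ∣_∣ (solve 3 (λ x y z → x :* y :- x :* z := x :* (y :- z)) refl
        (seq x n) (seq y n) (seq z n))))
      (ℚ.≤-trans (*-mono₂ (seq x n) (seq y n ℚ.- seq z n) p q)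
        (ℚ.≤-reflexive (K*[inv[K]*ε]≡ε ε K>0))))
    b (h (inv K ℚ.* ε) (*-pos (inv>0 K>0) ε>0))

*-comm : ∀ x y → x * y ≈ y * x
*-comm x y = ≡⇒≈ {x * y} {y * x} λ n → ℚ.*-comm (seq x n) (seq y n)

*-assoc : ∀ x y z → x * y * z ≈ x * (y * z)
*-assoc x y z = ≡⇒≈ {x * y * z} {x * (y * z)} λ n → ℚ.*-assoc (seq x n) (seq y n) (seq z n)

*-congʳ : ∀ x {y z} → y ≈ z → y * x ≈ z * x
*-congʳ x {y} {z} h = begin-equality
  y * x ≈⟨ *-comm y x ⟩
  x * y ≈⟨ *-congˡ x {y} {z} h ⟩
  x * z ≈⟨ *-comm x z ⟩
  z * x ∎
  where open ℝ-Reasoning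

-- Early terms of a positive real may have any sign; the gap `e` keeps the late ones away from zero.
eventually≥ : ∀ {x} → 0ℝ < x → ∃[ e ] 0ℚ ℚ.< e × Eventually (λ n → e ℚ.≤ seq x n)
eventually≥ (e , e>0 , h) =
  e , e>0 , mapE (λ n → ℚ.≤-trans (ℚ.≤-reflexive (sym (ℚ.+-identityˡ e)))) h

-- The lower bound `e` makes late factors non-negative, so that termwise monotonicity applies; the
-- upper bound `K` keeps the scaled error within `ε`.
*-monoʳ-≤ : ∀ {x y z} → 0ℝ < x → y ≤ z → x * y ≤ x * z
*-monoʳ-≤ {x} {y} {z} x>0 h ε ε>0 =
  let e , e>0 , a = eventually≥ {x} x>0
      K , K>0 , b = bounded (cauchy x)
      δ = inv K ℚ.* ε
      δ>0 = *-pos (inv>0 K>0) ε>0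
  in zipE
    (λ n (e≤x , x≤K) y≤z+δ → ℚ.≤-trans
      (ℚ.*-monoˡ-≤-nonNeg (seq x n) ⦃ ℚ.nonNegative (ℚ.≤-trans (ℚ.<⇒≤ e>0) e≤x) ⦄ y≤z+δ)
      (ℚ.≤-trans (ℚ.≤-reflexive (ℚ.*-distribˡ-+ (seq x n) (seq z n) δ))
        (ℚ.+-monoʳ-≤ (seq x n ℚ.* seq z n)
          (ℚ.≤-trans
            (ℚ.*-monoʳ-≤-nonNeg δ ⦃ ℚ.nonNegative (ℚ.<⇒≤ δ>0) ⦄ (ℚ.≤-trans (p≤∣p∣ (seq x n)) x≤K))
            (ℚ.≤-reflexive (K*[inv[K]*ε]≡ε ε K>0))))))
    (zipE (λ _ → _,_) a b) (h δ δ>0)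

*-monoʳ-< : ∀ {x y z} → 0ℝ < x → y < z → x * y < x * z
*-monoʳ-< {x} {y} {z} x>0 (ε , ε>0 , h) =
  let e , e>0 , a = eventually≥ {x} x>0
  in e ℚ.* ε , *-pos e>0 ε>0 , zipE
    (λ n e≤x y+ε≤z → ℚ.≤-trans
      (ℚ.+-monoʳ-≤ (seq x n ℚ.* seq y n)
        (ℚ.*-monoʳ-≤-nonNeg ε ⦃ ℚ.nonNegative (ℚ.<⇒≤ ε>0) ⦄ e≤x))
      (ℚ.≤-trans (ℚ.≤-reflexive (sym (ℚ.*-distribˡ-+ (seq x n) (seq y n) ε)))
        (ℚ.*-monoˡ-≤-nonNeg (seq x n) ⦃ ℚ.nonNegative (ℚ.≤-trans (ℚ.<⇒≤ e>0) e≤x) ⦄ y+ε≤z)))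
    a h

-- An eventual bound `K` on `x` gives `1 / K` as the gap.
recip>0 : ∀ {x} (x>0 : 0ℝ < x) → 0ℝ < recip x x>0
recip>0 {x} x>0 =
  let e , e>0 , a = eventually≥ {x} x>0
      K , K>0 , b = bounded (cauchy x)
  in inv K , inv>0 K>0 , zipE
    (λ n e≤x x≤K → let xₙ>0 = ℚ.<-≤-trans e>0 e≤x in
      ℚ.≤-trans (ℚ.≤-reflexive (trans (ℚ.+-identityˡ (inv K)) (sym (ℚ.0≤p⇒∣p∣≡p (ℚ.<⇒≤ (inv>0 K>0))))))
        (inv-antimono xₙ>0 (ℚ.≤-trans (p≤∣p∣ (seq x n)) x≤K)))
    a b

x/y*y≈x : ∀ x {y} (y>0 : 0ℝ < y) → x / y [ y>0 ] * y ≈ x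
x/y*y≈x x {y} y>0 =
  let e , e>0 , a = eventually≥ {y} y>0
  in ≡ᵉ⇒≈ {x / y [ y>0 ] * y} {x} (mapE
    (λ n e≤y → trans
      (solve 3 (λ x y i → x :* i :* y := x :* (y :* i)) refl (seq x n) (seq y n) (inv (seq y n)))
      (trans (cong (seq x n ℚ.*_) (q*inv (ℚ.<-≤-trans e>0 e≤y))) (ℚ.*-identityʳ (seq x n))))
    a)

x*y/y≈x : ∀ x {y} (y>0 : 0ℝ < y) → (x * y) / y [ y>0 ] ≈ x
x*y/y≈x x {y} y>0 = begin-equality
  (x * y) / y [ y>0 ] ≈⟨ *-assoc x y (recip y y>0) ⟩
  x * (y * recip y y>0) ≈⟨ *-congˡ x {y * recip y y>0} {recip y y>0 * y} (*-comm y (recip y y>0)) ⟩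
  x * (recip y y>0 * y) ≈⟨ *-assoc x (recip y y>0) y ⟨
  x / y [ y>0 ] * y ≈⟨ x/y*y≈x x {y} y>0 ⟩
  x ∎
  where open ℝ-Reasoning

-- Integer multiples of a real number

-- `_/_` normalises by a gcd, which is stuck on an open `i`; the `mkℚ` form lets sums, products and
-- comparisons reduce to integers.
i/1≡mkℚ : ∀ i → i ℚ./ 1 ≡ mkℚ i 0 (coprime-sym (1-coprimeTo ℤ.∣ i ∣))
i/1≡mkℚ i = ℚ.↥p/↧p≡p (mkℚ i 0 _)

/1-+ : ∀ i j → i ℚ./ 1 ℚ.+ j ℚ./ 1 ≡ (i ℤ.+ j) ℚ./ 1
/1-+ i j = trans (cong₂ ℚ._+_ (i/1≡mkℚ i) (i/1≡mkℚ j))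
  (cong (ℚ._/ 1) (cong₂ ℤ._+_ (ℤ.*-identityʳ i) (ℤ.*-identityʳ j)))

/1-* : ∀ i j → i ℚ./ 1 ℚ.* (j ℚ./ 1) ≡ (i ℤ.* j) ℚ./ 1
/1-* i j = cong₂ ℚ._*_ (i/1≡mkℚ i) (i/1≡mkℚ j)

/1-mono-≤ : ∀ {i j} → i ℤ.≤ j → i ℚ./ 1 ℚ.≤ j ℚ./ 1
/1-mono-≤ {i} {j} i≤j = subst₂ ℚ._≤_ (sym (i/1≡mkℚ i)) (sym (i/1≡mkℚ j))
  (ℚ.*≤* (ℤ.*-monoʳ-≤-nonNeg (+ 1) i≤j))

/1-mono-< : ∀ {i j} → i ℤ.< j → i ℚ./ 1 ℚ.< j ℚ./ 1
/1-mono-< {i} {j} i<j = subst₂ ℚ._<_ (sym (i/1≡mkℚ i)) (sym (i/1≡mkℚ j))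
  (ℚ.*<* (ℤ.*-monoʳ-<-pos (+ 1) i<j))

fromℚ-mono-≤ : ∀ {p q} → p ℚ.≤ q → fromℚ p ≤ fromℚ q
fromℚ-mono-≤ {p} {q} p≤q ε ε>0 = 0 , λ _ _ →
  ℚ.≤-trans p≤q (ℚ.≤-trans (ℚ.≤-reflexive (sym (ℚ.+-identityʳ q))) (ℚ.+-monoʳ-≤ q (ℚ.<⇒≤ ε>0)))

fromℚ-mono-< : ∀ {p q} → p ℚ.< q → fromℚ p < fromℚ q
fromℚ-mono-< {p} {q} p<q = q ℚ.- p
  , ℚ.≤-<-trans (ℚ.≤-reflexive (sym (ℚ.+-inverseʳ p))) (ℚ.+-monoˡ-< (ℚ.- p) p<q)
  , 0 , λ _ _ → ℚ.≤-reflexive (solve 2 (λ p q → p :+ (q :- p) := q) refl p q)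

fromℤ-mono-≤ : ∀ {i j} → i ℤ.≤ j → fromℤ i ≤ fromℤ j
fromℤ-mono-≤ {i} {j} i≤j = fromℚ-mono-≤ {i ℚ./ 1} {j ℚ./ 1} (/1-mono-≤ i≤j)

fromℤ-mono-< : ∀ {i j} → i ℤ.< j → fromℤ i < fromℤ j
fromℤ-mono-< {i} {j} i<j = fromℚ-mono-< {i ℚ./ 1} {j ℚ./ 1} (/1-mono-< i<j)

module _ (g : ℝ) where

  *-fromℕ-* : ∀ a b → fromℕ a * (g * fromℕ b) ≈ g * fromℕ (a ℕ.* b)
  *-fromℕ-* a b = ≡⇒≈ {fromℕ a * (g * fromℕ b)} {g * fromℕ (a ℕ.* b)} λ n → trans
    (solve 3 (λ a g b → a :* (g :* b) := g :* (a :* b)) refl ((+ a) ℚ./ 1) (seq g n) ((+ b) ℚ./ 1))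
    (cong (seq g n ℚ.*_) (trans (/1-* (+ a) (+ b)) (cong (ℚ._/ 1) (sym (ℤ.pos-* a b)))))

  *-fromℕ-0 : g * fromℕ 0 ≈ 0ℝ
  *-fromℕ-0 = ≡⇒≈ {g * fromℕ 0} {0ℝ} λ n → ℚ.*-zeroʳ (seq g n)

  *-fromℕ-1 : g * fromℕ 1 ≈ g
  *-fromℕ-1 = ≡⇒≈ {g * fromℕ 1} {g} λ n → ℚ.*-identityʳ (seq g n)

  *-fromℕ-+ : ∀ a b → g * fromℕ a + g * fromℕ b ≈ g * fromℕ (a ℕ.+ b)
  *-fromℕ-+ a b = ≡⇒≈ {g * fromℕ a + g * fromℕ b} {g * fromℕ (a ℕ.+ b)} λ n → trans
    (sym (ℚ.*-distribˡ-+ (seq g n) ((+ a) ℚ./ 1) ((+ b) ℚ./ 1)))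
    (cong (seq g n ℚ.*_) (/1-+ (+ a) (+ b)))

  *-fromℕ-suc : ∀ a → g * fromℕ a + g ≈ g * fromℕ (suc a)
  *-fromℕ-suc a = begin-equality
    g * fromℕ a + g           ≈⟨ +-cong {g * fromℕ a} {g * fromℕ a} {g} {g * fromℕ 1}
                                   (≈-refl {g * fromℕ a}) (≈-sym {g * fromℕ 1} {g} *-fromℕ-1) ⟩
    g * fromℕ a + g * fromℕ 1 ≈⟨ *-fromℕ-+ a 1 ⟩
    g * fromℕ (a ℕ.+ 1)       ≡⟨ cong (λ m → g * fromℕ m) {x = a ℕ.+ 1} {y = suc a} (ℕ.+-comm a 1) ⟩
    g * fromℕ (suc a)         ∎
    where open ℝ-Reasoning

  module _ (g>0 : 0ℝ < g) where

    -- Scaling by a non-negative rational commutes with maxima, and the terms of a positive `g` are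
    -- eventually non-negative.
    *-fromℕ-⊔ : ∀ a b → (g * fromℕ a) ⊔ (g * fromℕ b) ≈ g * fromℕ (a ℕ.⊔ b)
    *-fromℕ-⊔ a b =
      let e , e>0 , ev = eventually≥ {g} g>0
      in ≡ᵉ⇒≈ {(g * fromℕ a) ⊔ (g * fromℕ b)} {g * fromℕ (a ℕ.⊔ b)} (mapE
        (λ n e≤g → trans
          (sym (ℚ.*-distribˡ-⊔-nonNeg (seq g n)
            ⦃ ℚ.nonNegative (ℚ.≤-trans (ℚ.<⇒≤ e>0) e≤g) ⦄ ((+ a) ℚ./ 1) ((+ b) ℚ./ 1)))
          (cong (seq g n ℚ.*_) /1-⊔))
        ev)
      where
      /1-⊔ : (+ a) ℚ./ 1 ℚ.⊔ (+ b) ℚ./ 1 ≡ (+ (a ℕ.⊔ b)) ℚ./ 1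
      /1-⊔ with ℕ.≤-total a b
      ... | inj₁ a≤b = trans (ℚ.p≤q⇒p⊔q≡q (/1-mono-≤ (ℤ.+≤+ a≤b)))
                             (cong (λ m → (+ m) ℚ./ 1) (sym (ℕ.m≤n⇒m⊔n≡n a≤b)))
      ... | inj₂ b≤a = trans (ℚ.p≥q⇒p⊔q≡p (/1-mono-≤ (ℤ.+≤+ b≤a)))
                             (cong (λ m → (+ m) ℚ./ 1) (sym (ℕ.m≥n⇒m⊔n≡m b≤a)))

    *-fromℤ-mono-≤ : ∀ {i j} → i ℤ.≤ j → g * fromℤ i ≤ g * fromℤ j
    *-fromℤ-mono-≤ {i} {j} i≤j = *-monoʳ-≤ {g} {fromℤ i} {fromℤ j} g>0 (fromℤ-mono-≤ i≤j)

    *-fromℤ-mono-< : ∀ {i j} → i ℤ.< j → g * fromℤ i < g * fromℤ j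
    *-fromℤ-mono-< {i} {j} i<j = *-monoʳ-< {g} {fromℤ i} {fromℤ j} g>0 (fromℤ-mono-< i<j)

    *-fromℤ-cancel-< : ∀ {i j} → g * fromℤ i < g * fromℤ j → i ℤ.< j
    *-fromℤ-cancel-< {i} {j} h = ℤ.≰⇒> λ j≤i → <-irrefl {g * fromℤ i}
      (<-≤-trans {g * fromℤ i} {g * fromℤ j} {g * fromℤ i} h (*-fromℤ-mono-≤ j≤i))

    *-fromℕ-cancel-< : ∀ {a b} → g * fromℕ a < g * fromℕ b → a ℕ.< b
    *-fromℕ-cancel-< h = ℤ.drop‿+<+ (*-fromℤ-cancel-< h)

    *-fromℕ-injective : ∀ {a b} → g * fromℕ a ≈ g * fromℕ b → a ≡ b
    *-fromℕ-injective {a} {b} h with ℕ.<-cmp a b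
    ... | tri≈ _ a≡b _ = a≡b
    ... | tri< a<b _ _ = contradiction
      (<-≤-trans {g * fromℕ a} {g * fromℕ b} {g * fromℕ a} (*-fromℤ-mono-< (ℤ.+<+ a<b))
        (≈⇒≤ {g * fromℕ b} {g * fromℕ a} (≈-sym {g * fromℕ a} {g * fromℕ b} h)))
      (<-irrefl {g * fromℕ a})
    ... | tri> _ _ b<a = contradiction
      (<-≤-trans {g * fromℕ b} {g * fromℕ a} {g * fromℕ b} (*-fromℤ-mono-< (ℤ.+<+ b<a))
        (≈⇒≤ {g * fromℕ a} {g * fromℕ b} h))
      (<-irrefl {g * fromℕ b})

-- The quotient is an integer; a negative one would make `y` negative.
∣ℝ⇒multiple : ∀ {x y} → x ∣ℝ y → 0ℝ ≤ y → ∃[ m ] y ≈ x * fromℕ m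
∣ℝ⇒multiple {x} {y} (x>0 , z , y/x≈z) y≥0 = multiple z y≈xz
  where
  open ℝ-Reasoning
  y≈xz : y ≈ x * fromℤ z
  y≈xz = begin-equality
    y                   ≈⟨ x/y*y≈x y {x} x>0 ⟨
    y / x [ x>0 ] * x   ≈⟨ *-congʳ x {y / x [ x>0 ]} {fromℤ z} y/x≈z ⟩
    fromℤ z * x         ≈⟨ *-comm (fromℤ z) x ⟩
    x * fromℤ z         ∎
  multiple : ∀ i → y ≈ x * fromℤ i → ∃[ m ] y ≈ x * fromℕ m
  multiple (+ m)    h = m , h
  multiple -[1+ m ] h = contradiction
    (begin-strict
      0ℝ                   ≤⟨ y≥0 ⟩
      y                    ≈⟨ h ⟩
      x * fromℤ -[1+ m ]   <⟨ *-fromℤ-mono-< x x>0 { -[1+ m ]} {+ 0} ℤ.-<+ ⟩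
      x * fromℕ 0          ≈⟨ *-fromℕ-0 x ⟩
      0ℝ                   ∎)
    (<-irrefl {0ℝ})

multiple⇒∣ℝ : ∀ {x y} m → 0ℝ < x → y ≈ x * fromℕ m → x ∣ℝ y
multiple⇒∣ℝ {x} {y} m x>0 h = x>0 , + m , (begin-equality
  y / x [ x>0 ]               ≈⟨ *-congʳ (recip x x>0) {y} {x * fromℕ m} h ⟩
  (x * fromℕ m) / x [ x>0 ]   ≈⟨ *-congʳ (recip x x>0) {x * fromℕ m} {fromℕ m * x} (*-comm x (fromℕ m)) ⟩
  (fromℕ m * x) / x [ x>0 ]   ≈⟨ x*y/y≈x (fromℕ m) {x} x>0 ⟩
  fromℕ m                     ∎)
  where open ℝ-Reasoning

-- Floors and ceilings of quotients

floor⇒bounds : ∀ {x y i} → IsFloorOfQuotient x y i → y * fromℤ i ≤ x × x < y * fromℤ (ℤ.suc i)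
floor⇒bounds {x} {y} {i} (y>0 , lo , hi) =
  (begin
    y * fromℤ i         ≤⟨ *-monoʳ-≤ {y} {fromℤ i} {x / y [ y>0 ]} y>0 lo ⟩
    y * (x / y [ y>0 ]) ≈⟨ y*[x/y]≈x ⟩
    x                   ∎) ,
  (begin-strict
    x                         ≈⟨ y*[x/y]≈x ⟨
    y * (x / y [ y>0 ])       <⟨ *-monoʳ-< {y} {x / y [ y>0 ]} {fromℤ (ℤ.suc i)} y>0 hi ⟩
    y * fromℤ (ℤ.suc i)       ∎)
  where
  open ℝ-Reasoning
  y*[x/y]≈x : y * (x / y [ y>0 ]) ≈ x
  y*[x/y]≈x = ≈-trans {y * (x / y [ y>0 ])} {x / y [ y>0 ] * y} {x}
    (*-comm y (x / y [ y>0 ])) (x/y*y≈x x {y} y>0)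

module _ {y : ℝ} (y>0 : 0ℝ < y) where
  open ℝ-Reasoning

  /-mono-≤ : ∀ {x z} → x ≤ z → x / y [ y>0 ] ≤ z / y [ y>0 ]
  /-mono-≤ {x} {z} h = begin
    x / y [ y>0 ]     ≈⟨ *-comm x (recip y y>0) ⟩
    recip y y>0 * x   ≤⟨ *-monoʳ-≤ {recip y y>0} {x} {z} (recip>0 {y} y>0) h ⟩
    recip y y>0 * z   ≈⟨ *-comm (recip y y>0) z ⟩
    z / y [ y>0 ]     ∎

  /-mono-< : ∀ {x z} → x < z → x / y [ y>0 ] < z / y [ y>0 ]
  /-mono-< {x} {z} h = begin-strict
    x / y [ y>0 ]     ≈⟨ *-comm x (recip y y>0) ⟩
    recip y y>0 * x   <⟨ *-monoʳ-< {recip y y>0} {x} {z} (recip>0 {y} y>0) h ⟩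
    recip y y>0 * z   ≈⟨ *-comm (recip y y>0) z ⟩
    z / y [ y>0 ]     ∎

  floorOfQuotient : ∀ {x i} → fromℤ i * y ≤ x → x < fromℤ (ℤ.suc i) * y → IsFloorOfQuotient x y i
  floorOfQuotient {x} {i} lo hi = y>0 ,
    (begin
      fromℤ i                     ≈⟨ x*y/y≈x (fromℤ i) {y} y>0 ⟨
      (fromℤ i * y) / y [ y>0 ]   ≤⟨ /-mono-≤ {fromℤ i * y} {x} lo ⟩
      x / y [ y>0 ]               ∎) ,
    (begin-strict
      x / y [ y>0 ]                       <⟨ /-mono-< {x} {fromℤ (ℤ.suc i) * y} hi ⟩
      (fromℤ (ℤ.suc i) * y) / y [ y>0 ]   ≈⟨ x*y/y≈x (fromℤ (ℤ.suc i)) {y} y>0 ⟩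
      fromℤ (ℤ.suc i)                     ∎)

  ceilingOfQuotient : ∀ {x i} → fromℤ (ℤ.pred i) * y < x → x ≤ fromℤ i * y → IsCeilingOfQuotient x y i
  ceilingOfQuotient {x} {i} lo hi = y>0 ,
    (begin-strict
      fromℤ (ℤ.pred i)                     ≈⟨ x*y/y≈x (fromℤ (ℤ.pred i)) {y} y>0 ⟨
      (fromℤ (ℤ.pred i) * y) / y [ y>0 ]   <⟨ /-mono-< {fromℤ (ℤ.pred i) * y} {x} lo ⟩
      x / y [ y>0 ]                        ∎) ,
    (begin
      x / y [ y>0 ]               ≤⟨ /-mono-≤ {x} {fromℤ i * y} hi ⟩
      (fromℤ i * y) / y [ y>0 ]   ≈⟨ x*y/y≈x (fromℤ i) {y} y>0 ⟩
      fromℤ i                     ∎)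

-- Local search over colourings with natural interferences

module ∑ = Algebra.Properties.Semiring.Sum ℕ.+-*-semiring
open ∑ using () renaming (sum to ∑)

sum-tabulate : ∀ {n} (f : Fin n → ℕ) → ℕ.sum (tabulate f) ≡ ∑ f
sum-tabulate {zero}  f = refl
sum-tabulate {suc n} f = cong (f zero ℕ.+_) (sum-tabulate (f ∘ suc))

sum-map-allFin : ∀ {n} (f : Fin n → ℕ) → ℕ.sum (map f (allFin n)) ≡ ∑ f
sum-map-allFin f = trans (cong ℕ.sum (List.map-tabulate id f)) (sum-tabulate f)

sum-filter : ∀ {A : Set} {P : Pred A 0ℓ} (P? : Decidable P) (f : A → ℕ) xs →
  ℕ.sum (map f (filter P? xs)) ≡
  ℕ.sum (map (λ x → if does (P? x) then f x else 0) xs)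
sum-filter P? f []       = refl
sum-filter P? f (x ∷ xs) with does (P? x)
... | true  = cong (f x ℕ.+_) (sum-filter P? f xs)
... | false = sum-filter P? f xs

∑-mono-≤ : ∀ {n} {f g : Fin n → ℕ} → (∀ i → f i ℕ.≤ g i) → ∑ f ℕ.≤ ∑ g
∑-mono-≤ {zero}  f≤g = z≤n
∑-mono-≤ {suc n} f≤g = ℕ.+-mono-≤ (f≤g zero) (∑-mono-≤ (f≤g ∘ suc))

∑-const : ∀ n m → ∑ {n} (const m) ≡ n ℕ.* m
∑-const zero    m = refl
∑-const (suc n) m = cong (m ℕ.+_) (∑-const n m)

-- `inject≤` selects the first `m` indices, and the omitted terms are natural numbers. This passes
-- the bound on row sums to a submatrix.
∑-inject≤ : ∀ {m n} (m≤n : m ℕ.≤ n) (f : Fin n → ℕ) → ∑ (λ i → f (inject≤ i m≤n)) ℕ.≤ ∑ f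
∑-inject≤ {zero}          m≤n f = z≤n
∑-inject≤ {suc m} {suc n} m≤n f = ℕ.+-monoʳ-≤ (f zero) (∑-inject≤ (ℕ.s≤s⁻¹ m≤n) (f ∘ suc))

-- Without their terms at `v` the two sums coincide; each side adds both terms at `v` to this
-- remainder, which avoids subtraction.
∑-agree-off : ∀ {n} (v : Fin n) (f g : Fin n → ℕ) → (∀ x → x ≢ v → f x ≡ g x) →
  ∑ f ℕ.+ g v ≡ ∑ g ℕ.+ f v
∑-agree-off {suc n} v f g f≡g = begin
  ∑ f ℕ.+ g v                        ≡⟨ cong (ℕ._+ g v) (∑.sum-remove {i = v} f) ⟩
  f v ℕ.+ ∑ (removeAt f v) ℕ.+ g v   ≡⟨ cong (λ r → f v ℕ.+ r ℕ.+ g v)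
                                          (∑.sum-cong-≗ λ j → f≡g (punchIn v j) (Fin.punchInᵢ≢i v j)) ⟩
  f v ℕ.+ ∑ (removeAt g v) ℕ.+ g v   ≡⟨ swap (f v) (∑ (removeAt g v)) (g v) ⟩
  g v ℕ.+ ∑ (removeAt g v) ℕ.+ f v   ≡⟨ cong (ℕ._+ f v) (∑.sum-remove {i = v} g) ⟨
  ∑ g ℕ.+ f v                        ∎
  where
  open ≡-Reasoning
  swap : ∀ a b c → a ℕ.+ b ℕ.+ c ≡ c ℕ.+ b ℕ.+ a
  swap = solve-∀

module _ {n} (G : Graph n) where
  open Graph G

  -- Weights 0 and 1 turn sums over neighbours into sums over all vertices, so that the order of
  -- summation can be exchanged.
  adj : Fin n → Fin n → ℕ
  adj v u = if does (v ~? u) then 1 else 0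

  adj-sym : ∀ v u → adj v u ≡ adj u v
  adj-sym v u with v ~? u | u ~? v
  ... | yes _   | yes _   = refl
  ... | no  _   | no  _   = refl
  ... | yes v~u | no  u≁v = contradiction (~-sym v~u) u≁v
  ... | no  v≁u | yes u~v = contradiction (~-sym u~v) v≁u

  adj-irrefl : ∀ v → adj v v ≡ 0
  adj-irrefl v = cong (if_then 1 else 0) (dec-false (v ~? v) (~-irrefl refl))

  sum-neighbours : ∀ v (f : Fin n → ℕ) →
    ℕ.sum (map f (neighbours v)) ≡ ∑ λ u → adj v u ℕ.* f u
  sum-neighbours v f = trans (sum-filter (v ~?_) f (allFin n))
    (trans (sum-map-allFin (λ u → if does (v ~? u) then f u else 0))
      (∑.sum-cong-≗ λ u → if-* (does (v ~? u)) (f u)))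
    where
    if-* : ∀ b m → (if b then m else 0) ≡ (if b then 1 else 0) ℕ.* m
    if-* true  m = sym (ℕ.+-identityʳ m)
    if-* false m = refl

  ∑-adj≤Δ : ∀ v → ∑ (adj v) ℕ.≤ Δ
  ∑-adj≤Δ v = subst (ℕ._≤ Δ) degree≡
    (All.lookup (List.xs≤max 0 (map degree (allFin n))) (∈-map⁺ degree (∈-allFin v)))
    where
    length≡sum : ∀ {A : Set} (xs : List A) → length xs ≡ ℕ.sum (map (const 1) xs)
    length≡sum []       = refl
    length≡sum (x ∷ xs) = cong suc (length≡sum xs)
    degree≡ : degree v ≡ ∑ (adj v)
    degree≡ = trans (length≡sum (neighbours v)) (trans (sum-neighbours v (const 1))
      (∑.sum-cong-≗ λ u → ℕ.*-identityʳ (adj v u)))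

  module LocalSearch {k} (w : Fin (suc k) → Fin (suc k) → ℕ) (w-sym : ∀ i j → w i j ≡ w j i)
    (M T : ℕ) (rows≤M : ∀ i → ∑ (w i) ℕ.≤ M) (ΔM<k[1+T] : Δ ℕ.* M ℕ.< suc k ℕ.* suc T) where

    -- The interference at `v` if `v` had colour `a` and all other vertices kept theirs; the current
    -- colour of `v` has weight zero.
    cost : (Fin n → Fin (suc k)) → Fin n → Fin (suc k) → ℕ
    cost c v a = ∑ λ u → adj v u ℕ.* w (c u) a

    -- Total interference: each edge is counted from both of its ends.
    potential : (Fin n → Fin (suc k)) → ℕ
    potential c = ∑ λ v → cost c v (c v)

    -- After the exchange of sums, each neighbour `u` contributes one row sum of `w`, at most `M`,
    -- and `v` has at most `Δ` neighbours.
    ∑-cost : ∀ c v → ∑ (cost c v) ℕ.≤ Δ ℕ.* M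
    ∑-cost c v = begin
      ∑ (λ a → ∑ λ u → adj v u ℕ.* w (c u) a)   ≡⟨ ∑.∑-comm (λ a u → adj v u ℕ.* w (c u) a) ⟩
      ∑ (λ u → ∑ λ a → adj v u ℕ.* w (c u) a)   ≡⟨ ∑.sum-cong-≗ (λ u → ∑.*-distribˡ-sum (adj v u) (w (c u))) ⟨
      ∑ (λ u → adj v u ℕ.* ∑ (w (c u)))         ≤⟨ ∑-mono-≤ (λ u → ℕ.*-monoʳ-≤ (adj v u) (rows≤M (c u))) ⟩
      ∑ (λ u → adj v u ℕ.* M)                   ≡⟨ ∑.*-distribʳ-sum M (adj v) ⟨
      ∑ (adj v) ℕ.* M                           ≤⟨ ℕ.*-monoˡ-≤ M (∑-adj≤Δ v) ⟩
      Δ ℕ.* M                                   ∎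
      where open ℕ.≤-Reasoning

    -- Averaging: if every colour cost at least `suc T`, the costs would sum to at least
    -- `suc k * suc T`, which exceeds `Δ * M`.
    cheapColour : ∀ c v → ∃[ a ] cost c v a ℕ.≤ T
    cheapColour c v with Fin.any? (λ a → cost c v a ℕ.≤? T)
    ... | yes found = found
    ... | no  none  = contradiction ΔM<k[1+T] (ℕ.≤⇒≯ (begin
      suc k ℕ.* suc T           ≡⟨ ∑-const (suc k) (suc T) ⟨
      ∑ {suc k} (const (suc T)) ≤⟨ ∑-mono-≤ (λ a → ℕ.≰⇒> λ cheap → none (a , cheap)) ⟩
      ∑ (cost c v)              ≤⟨ ∑-cost c v ⟩
      Δ ℕ.* M                   ∎))
      where open ℕ.≤-Reasoning

    recolour : (Fin n → Fin (suc k)) → Fin n → Fin (suc k) → (Fin n → Fin (suc k))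
    recolour c v a = updateAt c v (const a)

    -- Both sides are moved so that no subtraction occurs.  Summed over x with
    -- b = c x, the last terms become the costs of c v and of a at v, by symmetry.
    cost-recolour : ∀ c v a x b →
      cost (recolour c v a) x b ℕ.+ adj x v ℕ.* w (c v) b ≡ cost c x b ℕ.+ adj x v ℕ.* w a b
    cost-recolour c v a x b = trans
      (∑-agree-off v (λ u → adj x u ℕ.* w (recolour c v a u) b) (λ u → adj x u ℕ.* w (c u) b)
        λ u u≢v → cong (λ d → adj x u ℕ.* w d b) (updateAt-minimal u v c u≢v))
      (cong (λ d → cost c x b ℕ.+ adj x v ℕ.* w d b) (updateAt-updates v c))

    -- The cost at `v` itself changes from that of `c v` to that of `a`, and by symmetry the costs
    -- at its neighbours change by the same total; hence the factor 2.
    potential-recolour : ∀ c v a →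
      potential (recolour c v a) ℕ.+ 2 ℕ.* cost c v (c v) ≡ potential c ℕ.+ 2 ℕ.* cost c v a
    potential-recolour c v a = begin
      Φ′ ℕ.+ 2 ℕ.* cost c v (c v)          ≡⟨ assoc Φ′ (cost c v (c v)) ⟩
      Φ′ ℕ.+ cost c v (c v) ℕ.+ cost c v (c v)
        ≡⟨ cong₂ ℕ._+_ (sym ∑new) (sym old-v) ⟩
      ∑ new ℕ.+ old v                      ≡⟨ ∑-agree-off v new old new≡old ⟩
      ∑ old ℕ.+ new v                      ≡⟨ cong₂ ℕ._+_ ∑old new-v ⟩
      potential c ℕ.+ cost c v a ℕ.+ cost c v a
        ≡⟨ assoc (potential c) (cost c v a) ⟨
      potential c ℕ.+ 2 ℕ.* cost c v a     ∎
      where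
      open ≡-Reasoning
      c′ = recolour c v a
      Φ′ = potential c′
      -- Each summand receives the contribution of `v` to `x` under the other colouring, so that the
      -- two agree at every `x` other than `v`.
      new old : Fin n → ℕ
      new x = cost c′ x (c′ x) ℕ.+ adj x v ℕ.* w (c v) (c x)
      old x = cost c  x (c  x) ℕ.+ adj x v ℕ.* w a (c x)

      assoc : ∀ p q → p ℕ.+ 2 ℕ.* q ≡ p ℕ.+ q ℕ.+ q
      assoc = solve-∀

      new≡old : ∀ x → x ≢ v → new x ≡ old x
      new≡old x x≢v = trans
        (cong (λ b → cost c′ x b ℕ.+ adj x v ℕ.* w (c v) (c x)) (updateAt-minimal x v c x≢v))
        (cost-recolour c v a x (c x))

      ∑-adj-cost : ∀ b → ∑ (λ x → adj x v ℕ.* w b (c x)) ≡ cost c v b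
      ∑-adj-cost b = ∑.sum-cong-≗ λ x → cong₂ ℕ._*_ (adj-sym x v) (w-sym b (c x))

      ∑new : ∑ new ≡ Φ′ ℕ.+ cost c v (c v)
      ∑new = trans (∑.∑-distrib-+ (λ x → cost c′ x (c′ x)) (λ x → adj x v ℕ.* w (c v) (c x)))
        (cong (Φ′ ℕ.+_) (∑-adj-cost (c v)))

      ∑old : ∑ old ≡ potential c ℕ.+ cost c v a
      ∑old = trans (∑.∑-distrib-+ (λ x → cost c x (c x)) (λ x → adj x v ℕ.* w a (c x)))
        (cong (potential c ℕ.+_) (∑-adj-cost a))

      +-adj : ∀ p q → p ℕ.+ adj v v ℕ.* q ≡ p
      +-adj p q = trans (cong (λ e → p ℕ.+ e ℕ.* q) (adj-irrefl v)) (ℕ.+-identityʳ p)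

      old-v : old v ≡ cost c v (c v)
      old-v = +-adj _ _

      -- Without a loop, `v` does not contribute to its own cost, so recolouring it leaves the cost
      -- of `a` there unchanged.
      new-v : new v ≡ cost c v a
      new-v = begin
        new v                                   ≡⟨ +-adj _ _ ⟩
        cost c′ v (c′ v)                        ≡⟨ cong (cost c′ v) (updateAt-updates v c) ⟩
        cost c′ v a                             ≡⟨ +-adj _ _ ⟨
        cost c′ v a ℕ.+ adj v v ℕ.* w (c v) a   ≡⟨ cost-recolour c v a v a ⟩
        cost c v a ℕ.+ adj v v ℕ.* w a a        ≡⟨ +-adj _ _ ⟩
        cost c v a                              ∎

    -- Terminates because the potential is a natural number that `drop` makes smaller at each move.
    settle : ∀ c → Acc ℕ._<_ (potential c) → ∃[ d ] ∀ v → cost d v (d v) ℕ.≤ T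
    settle c (acc smaller) with Fin.all? (λ v → cost c v (c v) ℕ.≤? T)
    ... | yes done = c , done
    ... | no  ¬done with Fin.¬∀⟶∃¬ n _ (λ v → cost c v (c v) ℕ.≤? T) ¬done
    ...   | v , unhappy with cheapColour c v
    ...     | a , cheap = settle (recolour c v a) (smaller drop)
      where
      open ℕ.≤-Reasoning
      drop : potential (recolour c v a) ℕ.< potential c
      -- The new colour costs at most `T` at `v`, the old one more than `T`.
      drop = ℕ.+-cancelʳ-< (2 ℕ.* cost c v a) _ _ (begin-strict
        potential (recolour c v a) ℕ.+ 2 ℕ.* cost c v a
          <⟨ ℕ.+-monoʳ-< (potential (recolour c v a))
               (ℕ.*-monoʳ-< 2 (ℕ.≤-<-trans cheap (ℕ.≰⇒> unhappy))) ⟩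
        potential (recolour c v a) ℕ.+ 2 ℕ.* cost c v (c v)
          ≡⟨ potential-recolour c v a ⟩
        potential c ℕ.+ 2 ℕ.* cost c v a ∎)

    goodColouring : ∃[ c ] ∀ v → cost c v (c v) ℕ.≤ T
    goodColouring = settle (const zero) (<-wellFounded _)

-- Reduction to natural interferences

lookup-injective : ∀ {A : Set} {xs : List A} → Unique xs →
  ∀ i j → lookup xs i ≡ lookup xs j → i ≡ j
lookup-injective (_  ∷ _) zero    zero    _  = refl
lookup-injective (x∉ ∷ _) zero    (suc j) eq = contradiction eq (All.lookup x∉ (∈-lookup j))
lookup-injective (x∉ ∷ _) (suc i) zero    eq = contradiction (sym eq) (All.lookup x∉ (∈-lookup i))
lookup-injective (_  ∷ u) (suc i) (suc j) eq = cong suc (lookup-injective u i j eq)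

-- Every used colour is `f a` for some `a`; choosing such an `a` for each position of the
-- duplicate-free list is injective.
coloursUsed-∘ : ∀ {n s k} (G : Graph n) (S : Spectrum s) (f : Fin k → Fin s) (c : Fin n → Fin k) →
  coloursUsed G S (f ∘ c) ℕ.≤ k
coloursUsed-∘ {n} {s} {k} G S f c = Fin.injective⇒≤ {f = proj₁ ∘ preimage} λ {i} {j} eq →
  lookup-injective (deduplicate-! Fin._≟_ (map (f ∘ c) (allFin n))) i j
    (trans (proj₂ (preimage i)) (trans (cong f eq) (sym (proj₂ (preimage j)))))
  where
  used = deduplicate Fin._≟_ (map (f ∘ c) (allFin n))
  preimage : ∀ i → ∃[ a ] lookup used i ≡ f a
  preimage i with ∈-map⁻ (f ∘ c) (∈-deduplicate⁻ Fin._≟_ (map (f ∘ c) (allFin n)) (∈-lookup {xs = used} i))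
  ... | v , _ , eq = c v , eq

-- Strong induction: either no smaller number satisfies `P`, or the search restarts from one that
-- does.
least : ∀ {P : ℕ → Set} → Decidable P → ∀ k → P k → ∃[ m ] m ℕ.≤ k × P m × (∀ j → P j → m ℕ.≤ j)
least {P} P? = <-rec HasLeast step
  where
  HasLeast : ℕ → Set
  HasLeast k = P k → ∃[ m ] m ℕ.≤ k × P m × (∀ j → P j → m ℕ.≤ j)
  step : ∀ k → (∀ {i} → i ℕ.< k → HasLeast i) → HasLeast k
  step k rec Pk with ℕ.anyUpTo? P? k
  ... | no  none = k , ℕ.≤-refl , Pk , λ j Pj → ℕ.≮⇒≥ λ j<k → none (j , j<k , Pj)
  ... | yes (i , i<k , Pi) with rec i<k Pi
  ...   | m , m≤i , Pm , minimal = m , ℕ.≤-trans m≤i (ℕ.<⇒≤ i<k) , Pm , minimal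

module Integral {n s} (G : Graph n) (S : Spectrum s) {g : ℝ} (g>0 : 0ℝ < g)
  (w : Fin s → Fin s → ℕ) (W≈gw : ∀ i j → Spectrum.W S i j ≈ g * fromℕ (w i j)) where
  open Graph G
  open Spectrum S
  open ℝ-Reasoning

  sum≈ : ∀ {A : Set} {f : A → ℝ} {h : A → ℕ} → (∀ x → f x ≈ g * fromℕ (h x)) →
    ∀ xs → sum (map f xs) ≈ g * fromℕ (ℕ.sum (map h xs))
  sum≈ f≈gh []       = ≈-sym {g * fromℕ 0} {0ℝ} (*-fromℕ-0 g)
  sum≈ {f = f} {h} f≈gh (x ∷ xs) = begin-equality
    f x + sum (map f xs)                              ≈⟨ +-cong {f x} {g * fromℕ (h x)} {sum (map f xs)}
                                                           {g * fromℕ (ℕ.sum (map h xs))} (f≈gh x) (sum≈ f≈gh xs) ⟩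
    g * fromℕ (h x) + g * fromℕ (ℕ.sum (map h xs))    ≈⟨ *-fromℕ-+ g (h x) (ℕ.sum (map h xs)) ⟩
    g * fromℕ (h x ℕ.+ ℕ.sum (map h xs))              ∎

  max≈ : ∀ {A : Set} {f : A → ℝ} {h : A → ℕ} → (∀ x → f x ≈ g * fromℕ (h x)) →
    ∀ xs → foldr _⊔_ 0ℝ (map f xs) ≈ g * fromℕ (foldr ℕ._⊔_ 0 (map h xs))
  max≈ f≈gh []       = ≈-sym {g * fromℕ 0} {0ℝ} (*-fromℕ-0 g)
  max≈ {f = f} {h} f≈gh (x ∷ xs) = begin-equality
    f x ⊔ foldr _⊔_ 0ℝ (map f xs)                                 ≈⟨ ⊔-cong {f x} {g * fromℕ (h x)}
        {foldr _⊔_ 0ℝ (map f xs)} {g * fromℕ (foldr ℕ._⊔_ 0 (map h xs))} (f≈gh x) (max≈ f≈gh xs) ⟩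
    (g * fromℕ (h x)) ⊔ (g * fromℕ (foldr ℕ._⊔_ 0 (map h xs)))    ≈⟨ *-fromℕ-⊔ g g>0 (h x) (foldr ℕ._⊔_ 0 (map h xs)) ⟩
    g * fromℕ (h x ℕ.⊔ foldr ℕ._⊔_ 0 (map h xs))                  ∎

  -- Symmetry of `W` holds up to `_≈_`; positivity of `g` turns it into an equality of natural
  -- numbers.
  w-sym : ∀ i j → w i j ≡ w j i
  w-sym i j = *-fromℕ-injective g g>0 {w i j} {w j i} (begin-equality
    g * fromℕ (w i j)   ≈⟨ W≈gw i j ⟨
    W i j               ≈⟨ W-sym i j ⟩
    W j i               ≈⟨ W≈gw j i ⟩
    g * fromℕ (w j i)   ∎)

  rowSumℕ : Fin s → ℕ
  rowSumℕ i = ℕ.sum (map (w i) (allFin s))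

  M : ℕ
  M = foldr ℕ._⊔_ 0 (map rowSumℕ (allFin s))

  ∑w≤M : ∀ i → ∑ (w i) ℕ.≤ M
  ∑w≤M i = subst (ℕ._≤ M) (sum-map-allFin (w i)) (≤max (∈-map⁺ rowSumℕ (∈-allFin i)))
    where
    ≤max : ∀ {m ms} → m ∈ ms → m ℕ.≤ foldr ℕ._⊔_ 0 ms
    ≤max {ms = m ∷ ms} (here refl)  = ℕ.m≤m⊔n m _
    ≤max {ms = m ∷ ms} (there m∈ms) = ℕ.≤-trans (≤max m∈ms) (ℕ.m≤n⊔m m _)

  ‖W‖≈gM : ‖W‖∞ ≈ g * fromℕ M
  ‖W‖≈gM = max≈ (λ i → sum≈ (W≈gw i) (allFin s)) (allFin s)

  Δ‖W‖≈gΔM : fromℕ Δ * ‖W‖∞ ≈ g * fromℕ (Δ ℕ.* M)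
  Δ‖W‖≈gΔM = begin-equality
    fromℕ Δ * ‖W‖∞             ≈⟨ *-congˡ (fromℕ Δ) {‖W‖∞} {g * fromℕ M} ‖W‖≈gM ⟩
    fromℕ Δ * (g * fromℕ M)    ≈⟨ *-fromℕ-* g Δ M ⟩
    g * fromℕ (Δ ℕ.* M)        ∎

  interferenceℕ : (Fin n → Fin s) → Fin n → ℕ
  interferenceℕ c v = ℕ.sum (map (λ u → w (c u) (c v)) (neighbours v))

  interference≈ : ∀ c v → interference G S c v ≈ g * fromℕ (interferenceℕ c v)
  interference≈ c v = sum≈ (λ u → W≈gw (c u) (c v)) (neighbours v)

  -- The two bounds characterise `T` as the floor of `t / g`, whether or not `t` is a multiple of
  -- `g`, so both cases of the theorem are covered.
  module Threshold {t : ℝ} {T : ℕ} (gT≤t : g * fromℕ T ≤ t) (t<g[1+T] : t < g * fromℕ (suc T)) where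

    colours : ℕ
    colours = suc (Δ ℕ.* M ℕ./ suc T)

    ΔM<colours*[1+T] : Δ ℕ.* M ℕ.< colours ℕ.* suc T
    ΔM<colours*[1+T] = subst (ℕ._< colours ℕ.* suc T) (sym (ℕ.m≡m%n+[m/n]*n (Δ ℕ.* M) (suc T)))
      (ℕ.+-monoˡ-< (Δ ℕ.* M ℕ./ suc T ℕ.* suc T) (ℕ.m%n<n (Δ ℕ.* M) (suc T)))

    -- For the quotient `q` of `Δ * M` by `suc T`, `q * suc T ≤ Δ * M < suc q * suc T`; scaled by
    -- `g`, the numerator `g * (Δ * M + 1)` lies above `q * d` and is at most `suc q * d`. The two
    -- bounds write the denominator differently, so `d` is general.
    isCeiling : ∀ {d} → d ≈ g * fromℕ (suc T) → IsCeilingOfQuotient (fromℕ Δ * ‖W‖∞ + g) d (+ colours)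
    isCeiling {d} d≈g[1+T] = ceilingOfQuotient {d} d>0 {fromℕ Δ * ‖W‖∞ + g} {+ colours}
      (begin-strict
        fromℕ q * d                       ≈⟨ *-congˡ (fromℕ q) {d} {g * fromℕ (suc T)} d≈g[1+T] ⟩
        fromℕ q * (g * fromℕ (suc T))     ≈⟨ *-fromℕ-* g q (suc T) ⟩
        g * fromℕ (q ℕ.* suc T)           <⟨ *-fromℤ-mono-< g g>0 {+ (q ℕ.* suc T)} {+ suc (Δ ℕ.* M)}
                                               (ℤ.+<+ (s≤s (ℕ.m/n*n≤m (Δ ℕ.* M) (suc T)))) ⟩
        g * fromℕ (suc (Δ ℕ.* M))         ≈⟨ numerator≈ ⟨
        fromℕ Δ * ‖W‖∞ + g                ∎)
      (begin
        fromℕ Δ * ‖W‖∞ + g                ≈⟨ numerator≈ ⟩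
        g * fromℕ (suc (Δ ℕ.* M))         ≤⟨ *-fromℤ-mono-≤ g g>0 {+ suc (Δ ℕ.* M)} {+ (colours ℕ.* suc T)}
                                               (ℤ.+≤+ ΔM<colours*[1+T]) ⟩
        g * fromℕ (colours ℕ.* suc T)     ≈⟨ *-fromℕ-* g colours (suc T) ⟨
        fromℕ colours * (g * fromℕ (suc T))
          ≈⟨ *-congˡ (fromℕ colours) {d} {g * fromℕ (suc T)} d≈g[1+T] ⟨
        fromℕ colours * d                 ∎)
      where
      q = Δ ℕ.* M ℕ./ suc T
      d>0 : 0ℝ < d
      d>0 = begin-strict
        0ℝ                  ≈⟨ *-fromℕ-0 g ⟨
        g * fromℕ 0         <⟨ *-fromℤ-mono-< g g>0 {+ 0} {+ suc T} (ℤ.+<+ (s≤s z≤n)) ⟩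
        g * fromℕ (suc T)   ≈⟨ d≈g[1+T] ⟨
        d                   ∎
      numerator≈ : fromℕ Δ * ‖W‖∞ + g ≈ g * fromℕ (suc (Δ ℕ.* M))
      numerator≈ = begin-equality
        fromℕ Δ * ‖W‖∞ + g          ≈⟨ +-cong {fromℕ Δ * ‖W‖∞} {g * fromℕ (Δ ℕ.* M)} {g} {g} Δ‖W‖≈gΔM (≈-refl {g}) ⟩
        g * fromℕ (Δ ℕ.* M) + g     ≈⟨ *-fromℕ-suc g (Δ ℕ.* M) ⟩
        g * fromℕ (suc (Δ ℕ.* M))   ∎

    -- From `g * Δ * M ≤ s * t < s * g * suc T` follows `Δ * M < s * suc T`, so the quotient in
    -- `colours` is below `s`.
    colours≤s : 1 ℕ.≤ s → fromℕ Δ * ‖W‖∞ ≤ fromℕ s * t → colours ℕ.≤ s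
    colours≤s s≥1 Δ‖W‖≤st = ℕ.m<n*o⇒m/o<n {Δ ℕ.* M} {s} {suc T}
      (*-fromℕ-cancel-< g g>0 {Δ ℕ.* M} {s ℕ.* suc T} (begin-strict
      g * fromℕ (Δ ℕ.* M)             ≈⟨ Δ‖W‖≈gΔM ⟨
      fromℕ Δ * ‖W‖∞                  ≤⟨ Δ‖W‖≤st ⟩
      fromℕ s * t                     <⟨ *-monoʳ-< {fromℕ s} {t} {g * fromℕ (suc T)}
                                           (fromℤ-mono-< {+ 0} {+ s} (ℤ.+<+ s≥1)) t<g[1+T] ⟩
      fromℕ s * (g * fromℕ (suc T))   ≈⟨ *-fromℕ-* g s (suc T) ⟩
      g * fromℕ (s ℕ.* suc T)         ∎))

    -- A multiple of `g` below `g * suc T` is at most `g * T`; thus replacing the threshold by `T`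
    -- loses nothing.
    interferenceℕ≤T : ∀ {c v} → interference G S c v ≤ t → interferenceℕ c v ℕ.≤ T
    interferenceℕ≤T {c} {v} h = ℕ.s≤s⁻¹ (*-fromℕ-cancel-< g g>0 {interferenceℕ c v} {suc T} (begin-strict
      g * fromℕ (interferenceℕ c v)   ≈⟨ interference≈ c v ⟨
      interference G S c v            ≤⟨ h ⟩
      t                               <⟨ t<g[1+T] ⟩
      g * fromℕ (suc T)               ∎))

    interference≤t : ∀ {c v} → interferenceℕ c v ℕ.≤ T → interference G S c v ≤ t
    interference≤t {c} {v} h = begin
      interference G S c v            ≈⟨ interference≈ c v ⟩
      g * fromℕ (interferenceℕ c v)   ≤⟨ *-fromℤ-mono-≤ g g>0 {+ interferenceℕ c v} {+ T} (ℤ.+≤+ h) ⟩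
      g * fromℕ T                     ≤⟨ gT≤t ⟩
      t                               ∎

    -- Order of reals is not decidable, so natural interferences are compared with `T` instead;
    -- colourings are enumerated through their codes in a finite set.
    admits? : ∀ j → Dec (Admits G S t j)
    admits? j = map′
      (λ (i , few , ok) → finToFun i , few , λ v → interference≤t {finToFun i} {v} (ok v))
      -- Decoding the code of `c` returns `c` only pointwise, so both conditions are transported
      -- along `_≗_`.
      (λ (c , few , ok) → let c′≗c = Fin.finToFun-funToFin c in funToFin c
        , subst (ℕ._≤ j) (sym (coloursUsed-cong c′≗c)) few
        , λ v → subst (ℕ._≤ T) (sym (interferenceℕ-cong c′≗c v)) (interferenceℕ≤T {c} {v} (ok v)))
      (Fin.any? λ i → (coloursUsed G S (finToFun i) ℕ.≤? j)
                ×-dec Fin.all? (λ v → interferenceℕ (finToFun i) v ℕ.≤? T))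
      where
      coloursUsed-cong : ∀ {c d : Fin n → Fin s} → c ≗ d → coloursUsed G S c ≡ coloursUsed G S d
      coloursUsed-cong c≗d = cong (length ∘ deduplicate Fin._≟_) (List.map-cong c≗d (allFin n))
      interferenceℕ-cong : ∀ {c d : Fin n → Fin s} → c ≗ d → ∀ v → interferenceℕ c v ≡ interferenceℕ d v
      interferenceℕ-cong c≗d v = cong ℕ.sum
        (List.map-cong (λ u → cong₂ w (c≗d u) (c≗d v)) (neighbours v))

    -- Local search runs on the first `colours` colours of the spectrum; the row sums of this
    -- submatrix are still at most `M`.
    admits-colours : colours ℕ.≤ s → Admits G S t colours
    admits-colours k≤s = embed ∘ c , coloursUsed-∘ G S embed c , λ v → interference≤t {embed ∘ c} {v}
      (subst (ℕ._≤ T) (sym (sum-neighbours G v (λ u → w (embed (c u)) (embed (c v))))) (good v))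
      where
      embed : Fin colours → Fin s
      embed a = inject≤ a k≤s
      open LocalSearch G (λ a b → w (embed a) (embed b)) (λ a b → w-sym (embed a) (embed b)) M T
        (λ a → ℕ.≤-trans (∑-inject≤ k≤s (w (embed a))) (∑w≤M (embed a))) ΔM<colours*[1+T]
      c = proj₁ goodColouring
      good = proj₂ goodColouring

    chromaticNumber : colours ℕ.≤ s → ∃[ χ ] IsChromaticNumber G S t χ × χ ℕ.≤ colours
    chromaticNumber k≤s =
      let χ , χ≤k , (χ≥1 , admits) , minimal =
            least (λ j → (1 ℕ.≤? j) ×-dec admits? j) colours (s≤s z≤n , admits-colours k≤s)
      in χ , (χ≥1 , admits , λ j j≥1 admits-j → minimal j (j≥1 , admits-j)) , χ≤k

-- The two upper bounds

¬floor-neg : ∀ {x y m} → 0ℝ ≤ x → ¬ IsFloorOfQuotient x y -[1+ m ]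
¬floor-neg {x} {y} {m} x≥0 floor@(y>0 , _) = <-irrefl {0ℝ}
  (begin-strict
    0ℝ                             ≤⟨ x≥0 ⟩
    x                              <⟨ proj₂ (floor⇒bounds {x} {y} { -[1+ m ]} floor) ⟩
    y * fromℤ (ℤ.suc -[1+ m ])     ≤⟨ *-fromℤ-mono-≤ y y>0 {ℤ.suc -[1+ m ]} {+ 0}
                                     (ℤ.i<j⇒suc[i]≤j { -[1+ m ]} {+ 0} ℤ.-<+) ⟩
    y * fromℕ 0                    ≈⟨ *-fromℕ-0 y ⟩
    0ℝ                             ∎)
  where open ℝ-Reasoning

multiple⇒bounds : ∀ {x y} m → 0ℝ < y → x ≈ y * fromℕ m → y * fromℕ m ≤ x × x < y * fromℕ (suc m)
multiple⇒bounds {x} {y} m y>0 x≈ym = ≈⇒≤ {y * fromℕ m} {x} (≈-sym {x} {y * fromℕ m} x≈ym) ,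
  ≤-<-trans {x} {y * fromℕ m} {y * fromℕ (suc m)} (≈⇒≤ {x} {y * fromℕ m} x≈ym)
    (*-fromℤ-mono-< y y>0 {+ m} {+ suc m} (ℤ.+<+ (ℕ.n<1+n m)))

module _ {n s} (G : Graph n) (S : Spectrum s) (g t : ℝ) (adm : Admissible G S g t) where
  open Graph G
  open Spectrum S
  open Admissible adm

  private
    g>0 : 0ℝ < g
    g>0 = proj₁ isGCD

    entries : ∀ i j → ∃[ m ] W i j ≈ g * fromℕ m
    entries i j = ∣ℝ⇒multiple {g} {W i j} (proj₁ (proj₂ isGCD) i j) (W-nonNeg i j)

  chromaticBound : ∀ {T} → g * fromℕ T ≤ t → t < g * fromℕ (suc T) → ∀ d → d ≈ g * fromℕ T + g →
    ∃[ χ ] ∃[ b ] IsChromaticNumber G S t χ ×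
      IsCeilingOfQuotient (fromℕ Δ * ‖W‖∞ + g) d b × + χ ≤ℤ b
  chromaticBound {T} lo hi d d≈gT+g = assemble (chromaticNumber (colours≤s (ℕ.<⇒≤ s≥2) Δ‖W‖≤st))
    where
    open Integral.Threshold G S {g} g>0 (λ i j → proj₁ (entries i j)) (λ i j → proj₂ (entries i j))
      {t} {T} lo hi
    assemble : ∃[ χ ] IsChromaticNumber G S t χ × χ ℕ.≤ colours →
      ∃[ χ ] ∃[ b ] IsChromaticNumber G S t χ × IsCeilingOfQuotient (fromℕ Δ * ‖W‖∞ + g) d b × + χ ≤ℤ b
    assemble (χ , isχ , χ≤k) = χ , + colours , isχ
      , isCeiling {d} (≈-trans {d} {g * fromℕ T + g} {g * fromℕ (suc T)} d≈gT+g (*-fromℕ-suc g T))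
      , ℤ.+≤+ χ≤k

  bound₁ : g ∣ℝ t → ∃[ χ ] ∃[ b ] IsChromaticNumber G S t χ × IsBound₁ G S g t b × + χ ≤ℤ b
  bound₁ g∣t =
    let T , t≈gT = ∣ℝ⇒multiple {g} {t} g∣t t≥0
        lo , hi  = multiple⇒bounds {t} {g} T g>0 t≈gT
    in chromaticBound {T} lo hi (t + g) (+-cong {t} {g * fromℕ T} {g} {g} t≈gT (≈-refl {g}))

  bound₂ : ∀ f → IsFloorOfQuotient t g f →
    ∃[ χ ] ∃[ b ] IsChromaticNumber G S t χ × IsBound₂ G S g f b × + χ ≤ℤ b
  bound₂ -[1+ m ] floor = contradiction floor (¬floor-neg {t} {g} {m} t≥0)
  bound₂ (+ T)    floor =
    let lo , hi = floor⇒bounds {t} {g} {+ T} floor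
    in chromaticBound {T} lo hi (g * fromℕ T + g) (≈-refl {g * fromℕ T + g})

-- Tightness of the bounds

complete : ∀ n → Graph n
complete n = record
  { _~_      = _≢_
  ; _~?_     = λ u v → ¬? (u Fin.≟ v)
  ; ~-sym    = λ u≢v → u≢v ∘ sym
  ; ~-irrefl = λ u≡v u≢v → u≢v u≡v
  }

module Tight where
  open ℝ-Reasoning

  -- The entry 1 forces gcd 1; the row sums are 4, so `Δ * M` is 4, and `T = 2` makes `colours`
  -- equal to `4 / 3 + 1 = 2`.
  w : Fin 2 → Fin 2 → ℕ
  w zero    zero    = 3
  w zero    (suc _) = 1
  w (suc _) zero    = 1
  w (suc _) (suc _) = 3

  w-sym : ∀ i j → w i j ≡ w j i
  w-sym zero    zero    = refl
  w-sym zero    (suc _) = refl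
  w-sym (suc _) zero    = refl
  w-sym (suc _) (suc _) = refl

  K₂ : Graph 2
  K₂ = complete 2

  S : Spectrum 2
  S = record
    { W        = λ i j → fromℕ (w i j)
    ; W-sym    = λ i j → ≡⇒≈ {fromℕ (w i j)} {fromℕ (w j i)} λ _ →
        cong (λ m → (+ m) ℚ./ 1) (w-sym i j)
    ; W-nonNeg = λ i j → fromℤ-mono-≤ {+ 0} {+ w i j} (ℤ.+≤+ z≤n)
    }
  open Spectrum S

  g : ℝ
  g = fromℕ 1

  g>0 : 0ℝ < g
  g>0 = fromℤ-mono-< {+ 0} {+ 1} (ℤ.+<+ (s≤s z≤n))

  fromℕ≈g* : ∀ m → fromℕ m ≈ g * fromℕ m
  fromℕ≈g* m = ≡⇒≈ {fromℕ m} {g * fromℕ m} λ _ → sym (ℚ.*-identityˡ ((+ m) ℚ./ 1))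

  isGCD : IsGCD g
  isGCD = g>0 , (λ i j → multiple⇒∣ℝ {g} {W i j} (w i j) g>0 (fromℕ≈g* (w i j))) , greatest
    where
    -- For a divisor `x` of the entry 1, the multiplier `m` in `1 = x * m` is positive, hence
    -- `x ≤ 1`.
    greatest : ∀ x → 0ℝ < x → DividesAll x → x ≤ g
    greatest x x>0 x∣W = uncurry x≤g (∣ℝ⇒multiple {x} {g} (x∣W zero (suc zero)) (<⇒≤ {0ℝ} {g} g>0))
      where
      x≤g : ∀ m → g ≈ x * fromℕ m → x ≤ g
      x≤g zero    g≈0  = contradiction
        (<-≤-trans {0ℝ} {g} {0ℝ} g>0
          (≈⇒≤ {g} {0ℝ} (≈-trans {g} {x * fromℕ 0} {0ℝ} g≈0 (*-fromℕ-0 x))))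
        (<-irrefl {0ℝ})
      x≤g (suc m) g≈xm = begin
        x                   ≈⟨ *-fromℕ-1 x ⟨
        x * fromℕ 1         ≤⟨ *-fromℤ-mono-≤ x x>0 {+ 1} {+ suc m} (ℤ.+≤+ (s≤s z≤n)) ⟩
        x * fromℕ (suc m)   ≈⟨ g≈xm ⟨
        g                   ∎

  open Integral K₂ S {g} g>0 w (λ i j → fromℕ≈g* (w i j))

  -- Shared by both examples, whose thresholds have the same floor 2.
  module _ {t : ℝ} (lo : g * fromℕ 2 ≤ t) (hi : t < g * fromℕ 3) where
    open Threshold {t} {2} lo hi

    admissible : Admissible K₂ S g t
    admissible = record
      { s≥2     = ℕ.≤-refl
      ; isGCD   = isGCD
      ; t≥0     = begin
          0ℝ             ≈⟨ *-fromℕ-0 g ⟨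
          g * fromℕ 0    ≤⟨ *-fromℤ-mono-≤ g g>0 {+ 0} {+ 2} (ℤ.+≤+ z≤n) ⟩
          g * fromℕ 2    ≤⟨ lo ⟩
          t              ∎
      ; Δ‖W‖≤st = begin
          fromℕ (Graph.Δ K₂) * ‖W‖∞    ≈⟨ Δ‖W‖≈gΔM ⟩
          -- `Δ * M` evaluates to 4, which is also the number of colours times `T`.
          g * fromℕ (2 ℕ.* 2)          ≈⟨ *-fromℕ-* g 2 2 ⟨
          fromℕ 2 * (g * fromℕ 2)      ≤⟨ *-monoʳ-≤ {fromℕ 2} {g * fromℕ 2} {t}
                                           (fromℤ-mono-< {+ 0} {+ 2} (ℤ.+<+ (s≤s z≤n))) lo ⟩
          fromℕ 2 * t                  ∎
      }

    ¬admits-1 : ¬ Admits K₂ S t 1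
    ¬admits-1 (c , few , ok) = conflict (c zero) (c (suc zero)) few (interferenceℕ≤T {c} {zero} (ok zero))
      where
      -- Two different colours exceed the allowed single one; a common colour gives interference 3,
      -- above `T = 2`.
      conflict : ∀ (a b : Fin 2) → length (deduplicate Fin._≟_ (a ∷ b ∷ [])) ℕ.≤ 1 → ¬ w b a ℕ.+ 0 ℕ.≤ 2
      conflict zero       zero       _         (s≤s (s≤s ()))
      conflict zero       (suc zero) (s≤s ())
      conflict (suc zero) zero       (s≤s ())
      conflict (suc zero) (suc zero) _         (s≤s (s≤s ()))

    χ≡2 : IsChromaticNumber K₂ S t 2
    χ≡2 = s≤s z≤n , admits-colours ℕ.≤-refl , λ where
      zero          ()
      (suc zero)    _ admits-1 → contradiction admits-1 ¬admits-1
      (suc (suc j)) _ _        → s≤s (s≤s z≤n)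

    ceiling : ∀ {d} → d ≈ g * fromℕ 2 + g → IsCeilingOfQuotient (fromℕ (Graph.Δ K₂) * ‖W‖∞ + g) d (+ 2)
    ceiling {d} d≈ = isCeiling {d} (≈-trans {d} {g * fromℕ 2 + g} {g * fromℕ 3} d≈ (*-fromℕ-suc g 2))

  tight₁ : ∃[ n ] ∃[ s ] Σ[ G ∈ Graph n ] Σ[ S ∈ Spectrum s ] ∃[ g ] ∃[ t ]
    Admissible G S g t × g ∣ℝ t × ∃[ χ ] IsChromaticNumber G S t χ × IsBound₁ G S g t (+ χ)
  tight₁ = 2 , 2 , K₂ , S , g , t , admissible {t} lo hi , multiple⇒∣ℝ {g} {t} 2 g>0 (fromℕ≈g* 2) , 2
    , χ≡2 {t} lo hi , ceiling {t} lo hi {t + g} (+-cong {t} {g * fromℕ 2} {g} {g} (fromℕ≈g* 2) (≈-refl {g}))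
    where
    t  = fromℕ 2
    lo = proj₁ (multiple⇒bounds {t} {g} 2 g>0 (fromℕ≈g* 2))
    hi = proj₂ (multiple⇒bounds {t} {g} 2 g>0 (fromℕ≈g* 2))

  tight₂ : ∃[ n ] ∃[ s ] Σ[ G ∈ Graph n ] Σ[ S ∈ Spectrum s ] ∃[ g ] ∃[ t ]
    Admissible G S g t × ¬ (g ∣ℝ t) × ∃[ f ] IsFloorOfQuotient t g f ×
    ∃[ χ ] IsChromaticNumber G S t χ × IsBound₂ G S g f (+ χ)
  tight₂ = 2 , 2 , K₂ , S , g , t , admissible {t} lo hi , g∤t , + 2
    , floorOfQuotient {g} g>0 {t} {+ 2} (<⇒≤ {fromℕ 2 * g} {t} 2g<t) t<3g
    , 2 , χ≡2 {t} lo hi , ceiling {t} lo hi {g * fromℕ 2 + g} (≈-refl {g * fromℕ 2 + g})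
    where
    t : ℝ
    t = fromℚ ((+ 5) ℚ./ 2)
    2<t : fromℕ 2 < t
    2<t = fromℚ-mono-< (from-yes ((+ 2) ℚ./ 1 ℚ.<? (+ 5) ℚ./ 2))
    t<3 : t < fromℕ 3
    t<3 = fromℚ-mono-< (from-yes ((+ 5) ℚ./ 2 ℚ.<? (+ 3) ℚ./ 1))
    g2<t : g * fromℕ 2 < t
    g2<t = ≤-<-trans {g * fromℕ 2} {fromℕ 2} {t}
      (≈⇒≤ {g * fromℕ 2} {fromℕ 2} (≈-sym {fromℕ 2} {g * fromℕ 2} (fromℕ≈g* 2))) 2<t
    lo : g * fromℕ 2 ≤ t
    lo = <⇒≤ {g * fromℕ 2} {t} g2<t
    hi : t < g * fromℕ 3
    hi = <-≤-trans {t} {fromℕ 3} {g * fromℕ 3} t<3 (≈⇒≤ {fromℕ 3} {g * fromℕ 3} (fromℕ≈g* 3))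
    2g<t : fromℕ 2 * g < t
    2g<t = ≤-<-trans {fromℕ 2 * g} {g * fromℕ 2} {t} (≈⇒≤ {fromℕ 2 * g} {g * fromℕ 2} (*-comm (fromℕ 2) g)) g2<t
    t<3g : t < fromℕ 3 * g
    t<3g = <-≤-trans {t} {g * fromℕ 3} {fromℕ 3 * g} hi (≈⇒≤ {g * fromℕ 3} {fromℕ 3 * g} (*-comm g (fromℕ 3)))
    -- A multiplier `m` would satisfy `2 < m < 3`.
    g∤t : ¬ (g ∣ℝ t)
    g∤t g∣t =
      let m , t≈gm = ∣ℝ⇒multiple {g} {t} g∣t (Admissible.t≥0 (admissible {t} lo hi))
          t≤gm = ≈⇒≤ {t} {g * fromℕ m} t≈gm
          gm≤t = ≈⇒≤ {g * fromℕ m} {t} (≈-sym {t} {g * fromℕ m} t≈gm)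
      in ℕ.<⇒≱
        (*-fromℕ-cancel-< g g>0 {2} {m} (<-≤-trans {g * fromℕ 2} {t} {g * fromℕ m} g2<t t≤gm))
        (ℕ.s≤s⁻¹ (*-fromℕ-cancel-< g g>0 {m} {3} (≤-<-trans {g * fromℕ m} {t} {g * fromℕ 3} gm≤t hi)))

theorem4 : ( ∀ {n s : ℕ} (G : Graph n) (S : Spectrum s) (g t : ℝ) → Admissible G S g t →
    ( g ∣ℝ t →
    ∃[ χ ] ∃[ b ] IsChromaticNumber G S t χ × IsBound₁ G S g t b × + χ ≤ℤ b )
    ×
    ( ¬ (g ∣ℝ t) → (f : ℤ) → IsFloorOfQuotient t g f →
    ∃[ χ ] ∃[ b ] IsChromaticNumber G S t χ × IsBound₂ G S g f b × + χ ≤ℤ b ) )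
    ×
    ( ∃[ n ] ∃[ s ] Σ[ G ∈ Graph n ] Σ[ S ∈ Spectrum s ] ∃[ g ] ∃[ t ]
    Admissible G S g t × g ∣ℝ t ×
    ∃[ χ ] IsChromaticNumber G S t χ × IsBound₁ G S g t (+ χ) )
    ×
    ( ∃[ n ] ∃[ s ] Σ[ G ∈ Graph n ] Σ[ S ∈ Spectrum s ] ∃[ g ] ∃[ t ]
    Admissible G S g t × ¬ (g ∣ℝ t) ×
    ∃[ f ] IsFloorOfQuotient t g f ×
    ∃[ χ ] IsChromaticNumber G S t χ × IsBound₂ G S g f (+ χ) )
theorem4 = (λ G S g t adm → bound₁ G S g t adm , λ _ → bound₂ G S g t adm) , Tight.tight₁ , Tight.tight₂
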